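{- Let $f(z)\in\mathbb{Q}[[z]]$ be a delta series. Define symmetric functions $r_n(X)$ and $c_n(X)$ by $$\prod_{x\in X}\frac{1}{1-f(z)x}=\sum_{n\ge0}r_n(X)z^n,\qquad \prod_{x\in X}\bigl(1-f(-z)x\bigr)=\sum_{n\ge0}c_n(X)z^n ,$$ and for every partition $\lambda$ let $P_\lambda(X)=\det\bigl(r_{\lambda_i+j-i}(X)\bigr)$. Then for every partition $\lambda$ with conjugate $\lambda'$, $$P_\lambda(X)=\det\bigl(c_{\lambda'_i+j-i}(X)\bigr).$$
   Context: A delta series is a formal power series that is invertible with respect to composition (zero constant term, nonzero linear coefficient). Symmetric functions are over $\mathbb{Q}$ in infinitely many variables $X=\{x_1,x_2,\dots\}$. By convention $r_n=c_n=0$ for $n<0$ (and $r_0=c_0=1$). The first determinant has size $n\times n$ for any $n$ at least the number of nonzero parts of $\lambda$, the second has size $m\times m$ for any $m$ at least the number of nonzero parts of $\lambda'$; the values do not depend on $n$, $m$. -}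

module Defs where

open import Algebra.Bundles.Raw using (RawRing)
import Algebra.Definitions.RawSemiring as RawSemiringDefs
import Algebra.Properties.CommutativeMonoid.Sum as SumProperties
open import Data.Empty using (⊥-elim)
open import Data.Fin.Base as Fin using (Fin; toℕ)
import Data.Fin.Properties as Fin
open import Data.Integer.Base as ℤ using (ℤ; +_; -[1+_])
open import Data.List.Base as List using (List; []; _∷_; _++_; length; filter; applyUpTo)
import Data.List.Properties as List
open import Data.List.Relation.Binary.Permutation.Propositional using (_↭_; refl; prep; swap; trans)
open import Data.List.Relation.Unary.All using (All; []; _∷_)
import Data.List.Relation.Unary.All.Properties as All
open import Data.List.Relation.Unary.Linked using (Linked)
import Data.List.Relation.Unary.Linked.Properties as Linked
open import Data.Nat.Base as ℕ using (ℕ; zero; suc; _∸_; _≤_; _<_; _≥_; s≤s; z≤n; z<s)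
open import Data.Nat.ListAction using (sum)
import Data.Nat.Properties as ℕ
open import Data.Nat.Tactic.RingSolver using (solve-∀)
open import Data.Product.Base using (∃; _,_; proj₁; proj₂)
open import Data.Rational.Base as ℚ using (ℚ; 0ℚ; 1ℚ)
import Data.Rational.Properties as ℚ
open import Data.Sum.Base using (_⊎_; inj₁; inj₂)
open import Data.Vec.Functional using (Vector; removeAt)
open import Function.Base using (_∘_)
open import Level using (Level; 0ℓ)
open import Relation.Binary.PropositionalEquality
  using (_≡_; _≢_; _≗_; refl; sym; cong; cong₂; subst)
  renaming (trans to ≡-trans)
open import Relation.Nullary using (yes; no)

private
  variable
    a ℓ : Level

module RawRingOps (R : RawRing a ℓ) where
  open RawRing R public
  open RawSemiringDefs rawSemiring public using (_^_)
    renaming (sum to ∑; product to ∏)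

  infixl 6 _-_
  _-_ : Carrier → Carrier → Carrier
  x - y = x + (- y)

  -- Laplace expansion along the first row.
  det : ∀ {n} → (Fin n → Fin n → Carrier) → Carrier
  det {zero}  M = 1#
  det {suc n} M =
    ∑ λ j → ((- 1#) ^ toℕ j) * M Fin.zero j * det (λ i → removeAt (M (Fin.suc i)) j)

_⟦z⟧ : RawRing a ℓ → RawRing a ℓ
R ⟦z⟧ = record
  { Carrier = ℕ → Carrier
  ; _≈_     = λ u v → ∀ n → u n ≈ v n
  ; _+_     = λ u v n → u n + v n
  ; _*_     = λ u v n → ∑ {suc n} λ k → u (toℕ k) * v (n ∸ toℕ k)
  ; -_      = λ u n → - u n
  ; 0#      = λ _ → 0#
  ; 1#      = λ { zero → 1# ; (suc _) → 0# }
  }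
  where open RawRingOps R

ℚ⟦z⟧ : Set
ℚ⟦z⟧ = RawRing.Carrier (ℚ.+-*-rawRing ⟦z⟧)

-- Over a field these conditions characterise invertibility under composition.
record IsDelta (f : ℚ⟦z⟧) : Set where
  field
    f₀≡0 : f 0 ≡ 0ℚ
    f₁≢0 : f 1 ≢ 0ℚ

_⟨-z⟩ : ℚ⟦z⟧ → ℚ⟦z⟧
(f ⟨-z⟩) n = ((ℚ.- 1ℚ) ^ n) ℚ.* f n
  where open RawRingOps ℚ.+-*-rawRing

-- The list α₀ ∷ α₁ ∷ … ∷ [] stands for the monomial x₀^α₀ x₁^α₁ ⋯, with all
-- further exponents zero.  A monomial is thus represented by several lists,
-- differing by trailing zeros; a coefficient function F is a series in X when
-- it does not distinguish these (IsPadded below).  All series constructed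
-- here have this property.
ℚ⟦X⟧ : Set
ℚ⟦X⟧ = List ℕ → ℚ

module _ where
  open RawRingOps ℚ.+-*-rawRing

  -- The coefficient of x₀^k, as a series in x₁, x₂, ….
  slice : ℚ⟦X⟧ → ℕ → ℚ⟦X⟧
  slice F k α = F (k ∷ α)

  constX : ℚ → ℚ⟦X⟧
  constX q []          = q
  constX q (zero  ∷ α) = constX q α
  constX q (suc _ ∷ α) = 0ℚ

  x : ℕ → ℚ⟦X⟧
  x i       []              = 0ℚ
  x zero    (1 ∷ α)         = constX 1ℚ α
  x zero    (_ ∷ α)         = 0ℚ
  x (suc i) (zero ∷ α)      = x i α
  x (suc i) (suc _ ∷ α)     = 0ℚ

  _+X_ _*X_ : ℚ⟦X⟧ → ℚ⟦X⟧ → ℚ⟦X⟧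
  (F +X G) α       = F α + G α
  -- Cauchy product, one variable at a time: the coefficient at α is the sum of
  -- F β * G γ over all β, γ with β + γ = α.
  (F *X G) []      = F [] * G []
  (F *X G) (k ∷ α) = ∑ {suc k} λ i → (slice F (toℕ i) *X slice G (k ∸ toℕ i)) α

  -X_ : ℚ⟦X⟧ → ℚ⟦X⟧
  (-X F) α = - F α

ℚ⟦X⟧-rawRing : RawRing 0ℓ 0ℓ
ℚ⟦X⟧-rawRing = record
  { Carrier = ℚ⟦X⟧
  ; _≈_     = _≗_
  ; _+_     = _+X_
  ; _*_     = _*X_
  ; -_      = -X_
  ; 0#      = constX 0ℚ
  ; 1#      = constX 1ℚ
  }

IsPadded : ℚ⟦X⟧ → Set
IsPadded F = ∀ α → F (α ++ 0 ∷ []) ≡ F α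

-- Together with IsPadded this is invariance under all finitary permutations of
-- the variables.
IsSymmetric : ℚ⟦X⟧ → Set
IsSymmetric F = ∀ {α β} → α ↭ β → F α ≡ F β

HasDegree≤ : ℕ → ℚ⟦X⟧ → Set
HasDegree≤ d F = ∀ α → d < sum α → F α ≡ 0ℚ

record Λ : Set where
  field
    series    : ℚ⟦X⟧
    padded    : IsPadded series
    symmetric : IsSymmetric series
    bounded   : ∃ λ d → HasDegree≤ d series

open Λ public using (series)

private
  open RawRingOps ℚ.+-*-rawRing using (∑)
  open SumProperties ℚ.+-0-commutativeMonoid
    using (sum-cong-≗; ∑-comm; sum-replicate-zero)

  ∑-zero : ∀ {n} {v : Vector ℚ n} → (∀ i → v i ≡ 0ℚ) → ∑ v ≡ 0ℚ
  ∑-zero {n} v≗0 = ≡-trans (sum-cong-≗ v≗0) (sum-replicate-zero n)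

  const-padded : ∀ q → IsPadded (constX q)
  const-padded q []          = refl
  const-padded q (zero  ∷ α) = const-padded q α
  const-padded q (suc _ ∷ α) = refl

  const-symmetric : ∀ q → IsSymmetric (constX q)
  const-symmetric q refl                   = refl
  const-symmetric q (prep zero p)          = const-symmetric q p
  const-symmetric q (prep (suc _) p)       = refl
  const-symmetric q (swap zero zero p)     = const-symmetric q p
  const-symmetric q (swap zero (suc _) p)  = refl
  const-symmetric q (swap (suc _) zero p)  = refl
  const-symmetric q (swap (suc _) (suc _) p) = refl
  const-symmetric q (trans p p′)           =
    ≡-trans (const-symmetric q p) (const-symmetric q p′)

  const-degree : ∀ q → HasDegree≤ 0 (constX q)
  const-degree q (zero  ∷ α) lt = const-degree q α lt
  const-degree q (suc _ ∷ α) lt = refl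

  *X-cong : ∀ {F F′ G G′} → F ≗ F′ → G ≗ G′ → (F *X G) ≗ (F′ *X G′)
  *X-cong F≗ G≗ []      = cong₂ ℚ._*_ (F≗ []) (G≗ [])
  *X-cong F≗ G≗ (k ∷ α) = sum-cong-≗ {suc k} λ i →
    *X-cong (F≗ ∘ (toℕ i ∷_)) (G≗ ∘ (k ∸ toℕ i ∷_)) α

  *-padded : ∀ {F G} → IsPadded F → IsPadded G → IsPadded (F *X G)
  *-padded pF pG []      = ≡-trans (ℚ.+-identityʳ _) (cong₂ ℚ._*_ (pF []) (pG []))
  *-padded pF pG (k ∷ α) = sum-cong-≗ {suc k} λ i →
    *-padded (pF ∘ (toℕ i ∷_)) (pG ∘ (k ∸ toℕ i ∷_)) α

  *-symmetric : ∀ {F G} → IsSymmetric F → IsSymmetric G → IsSymmetric (F *X G)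
  *-symmetric sF sG refl = refl
  *-symmetric sF sG (prep k p) = sum-cong-≗ {suc k} λ i →
    *-symmetric (sF ∘ prep (toℕ i)) (sG ∘ prep (k ∸ toℕ i)) p
  *-symmetric {F} {G} sF sG (swap {α} {β} k l p) = ≡-trans
    (sum-cong-≗ {suc k} λ i → sum-cong-≗ {suc l} λ j → ≡-trans
      (*-symmetric
        (sF ∘ prep (toℕ i) ∘ prep (toℕ j))
        (sG ∘ prep (k ∸ toℕ i) ∘ prep (l ∸ toℕ j)) p)
      (*X-cong
        (λ _ → sF (swap (toℕ i) (toℕ j) refl))
        (λ _ → sG (swap (k ∸ toℕ i) (l ∸ toℕ j) refl)) β))
    (∑-comm {suc k} {suc l} λ i j →
      (slice (slice F (toℕ j)) (toℕ i) *X slice (slice G (l ∸ toℕ j)) (k ∸ toℕ i)) β)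
  *-symmetric sF sG (trans p p′) = ≡-trans (*-symmetric sF sG p) (*-symmetric sF sG p′)

  +-<-split : ∀ d e a b → d ℕ.+ e < a ℕ.+ b → d < a ⊎ e < b
  +-<-split d e a b lt with d ℕ.<? a | e ℕ.<? b
  ... | yes d<a | _       = inj₁ d<a
  ... | no _    | yes e<b = inj₂ e<b
  ... | no d≮a  | no e≮b  =
    ⊥-elim (ℕ.<⇒≱ lt (ℕ.+-mono-≤ (ℕ.≮⇒≥ d≮a) (ℕ.≮⇒≥ e≮b)))

  *-degree-offset : ∀ {d e F G} a b →
    (∀ β → d < a ℕ.+ sum β → F β ≡ 0ℚ) → (∀ γ → e < b ℕ.+ sum γ → G γ ≡ 0ℚ) →
    ∀ α → d ℕ.+ e < (a ℕ.+ b) ℕ.+ sum α → (F *X G) α ≡ 0ℚ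
  *-degree-offset {d} {e} {F} {G} a b dF dG [] lt
    with +-<-split d e a b (subst (d ℕ.+ e <_) (ℕ.+-identityʳ _) lt)
  ... | inj₁ d<a = ≡-trans
    (cong (ℚ._* G []) (dF [] (subst (d <_) (sym (ℕ.+-identityʳ a)) d<a)))
    (ℚ.*-zeroˡ (G []))
  ... | inj₂ e<b = ≡-trans
    (cong (F [] ℚ.*_) (dG [] (subst (e <_) (sym (ℕ.+-identityʳ b)) e<b)))
    (ℚ.*-zeroʳ (F []))
  *-degree-offset {d} {e} {F} {G} a b dF dG (k ∷ α) lt = ∑-zero {suc k} λ i →
    *-degree-offset (a ℕ.+ toℕ i) (b ℕ.+ (k ∸ toℕ i))
      (λ β → dF (toℕ i ∷ β) ∘ subst (d <_) (ℕ.+-assoc a (toℕ i) (sum β)))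
      (λ γ → dG (k ∸ toℕ i ∷ γ) ∘ subst (e <_) (ℕ.+-assoc b (k ∸ toℕ i) (sum γ)))
      α (subst (d ℕ.+ e <_) (eq i) lt)
    where
    shuffle : ∀ a b i j s →
      (a ℕ.+ b) ℕ.+ ((i ℕ.+ j) ℕ.+ s) ≡ ((a ℕ.+ i) ℕ.+ (b ℕ.+ j)) ℕ.+ s
    shuffle = solve-∀
    eq : ∀ (i : Fin (suc k)) →
      (a ℕ.+ b) ℕ.+ (k ℕ.+ sum α) ≡
      ((a ℕ.+ toℕ i) ℕ.+ (b ℕ.+ (k ∸ toℕ i))) ℕ.+ sum α
    eq i = ≡-trans
      (cong (λ k′ → (a ℕ.+ b) ℕ.+ (k′ ℕ.+ sum α)) (sym (ℕ.m+[n∸m]≡n (Fin.toℕ≤pred[n] i))))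
      (shuffle a b (toℕ i) (k ∸ toℕ i) (sum α))

constΛ : ℚ → Λ
constΛ q = record
  { series    = constX q
  ; padded    = const-padded q
  ; symmetric = const-symmetric q
  ; bounded   = 0 , const-degree q
  }

_+Λ_ _*Λ_ : Λ → Λ → Λ
F +Λ G = record
  { series    = F.series +X G.series
  ; padded    = λ α → cong₂ ℚ._+_ (F.padded α) (G.padded α)
  ; symmetric = λ p → cong₂ ℚ._+_ (F.symmetric p) (G.symmetric p)
  ; bounded   = proj₁ F.bounded ℕ.+ proj₁ G.bounded , λ α lt → cong₂ ℚ._+_
      (proj₂ F.bounded α (ℕ.≤-<-trans (ℕ.m≤m+n _ _) lt))
      (proj₂ G.bounded α (ℕ.≤-<-trans (ℕ.m≤n+m _ _) lt))
  }
  where module F = Λ F ; module G = Λ G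
F *Λ G = record
  { series    = F.series *X G.series
  ; padded    = *-padded F.padded G.padded
  ; symmetric = *-symmetric F.symmetric G.symmetric
  ; bounded   = proj₁ F.bounded ℕ.+ proj₁ G.bounded ,
      *-degree-offset 0 0 (proj₂ F.bounded) (proj₂ G.bounded)
  }
  where module F = Λ F ; module G = Λ G

-Λ_ : Λ → Λ
-Λ F = record
  { series    = -X F.series
  ; padded    = λ α → cong ℚ.-_ (F.padded α)
  ; symmetric = λ p → cong ℚ.-_ (F.symmetric p)
  ; bounded   = proj₁ F.bounded , λ α lt → cong ℚ.-_ (proj₂ F.bounded α lt)
  }
  where module F = Λ F

Λ-rawRing : RawRing 0ℓ 0ℓ
Λ-rawRing = record
  { Carrier = Λ
  ; _≈_     = λ F G → series F ≗ series G
  ; _+_     = _+Λ_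
  ; _*_     = _*Λ_
  ; -_      = -Λ_
  ; 0#      = constΛ 0ℚ
  ; 1#      = constΛ 1ℚ
  }

ℚ⟦X⟧⟦z⟧-rawRing : RawRing 0ℓ 0ℓ
ℚ⟦X⟧⟦z⟧-rawRing = ℚ⟦X⟧-rawRing ⟦z⟧

ℚ⟦X⟧⟦z⟧ : Set
ℚ⟦X⟧⟦z⟧ = RawRing.Carrier ℚ⟦X⟧⟦z⟧-rawRing

module _ where
  open RawRingOps ℚ⟦X⟧⟦z⟧-rawRing

  _·x_ : ℚ⟦z⟧ → ℕ → ℚ⟦X⟧⟦z⟧
  (u ·x i) n = constX (u n) *X x i

  -- The geometric series 1/(1-u) = ∑ₖ u^k, for u with zero constant term in z:
  -- then u^k contributes to the coefficient of z^n only when k ≤ n.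
  1/[1-_] : ℚ⟦X⟧⟦z⟧ → ℚ⟦X⟧⟦z⟧
  1/[1- u ] n = RawRingOps.∑ ℚ⟦X⟧-rawRing {suc n} λ k → (u ^ toℕ k) n

  -- S = ∏_{x ∈ X} G x: every coefficient of the partial products
  -- G 0 * ⋯ * G (M - 1) is eventually constant, equal to that of S.
  IsProductOverX : (ℕ → ℚ⟦X⟧⟦z⟧) → ℚ⟦X⟧⟦z⟧ → Set
  IsProductOverX G S =
    ∀ n α → ∃ λ N → ∀ M → N ≤ M → ∏ {M} (G ∘ toℕ) n α ≡ S n α

  genFun : (ℕ → Λ) → ℚ⟦X⟧⟦z⟧
  genFun r n = series (r n)

  -- ∏_{x ∈ X} 1/(1 - f(z) x) = ∑ₙ rₙ(X) zⁿ
  Generates-r : ℚ⟦z⟧ → (ℕ → Λ) → Set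
  Generates-r f r = IsProductOverX (λ i → 1/[1- f ·x i ]) (genFun r)

  -- ∏_{x ∈ X} (1 - f(-z) x) = ∑ₙ cₙ(X) zⁿ
  Generates-c : ℚ⟦z⟧ → (ℕ → Λ) → Set
  Generates-c f c = IsProductOverX (λ i → 1# - ((f ⟨-z⟩) ·x i)) (genFun c)

record Partition : Set where
  field
    parts      : List ℕ
    decreasing : Linked _≥_ parts
    positive   : All (0 <_) parts

open Partition public using (parts)

ℓen : Partition → ℕ
ℓen μ = length (parts μ)

nth : List ℕ → ℕ → ℕ
nth []       _       = 0
nth (p ∷ ps) zero    = p
nth (p ∷ ps) (suc i) = nth ps i

-- Parts are numbered from 0: part μ i is μ_{i+1}, and is 0 for i ≥ ℓen μ.
part : Partition → ℕ → ℕ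
part μ = nth (parts μ)

-- conjPart ps j = #{ i ∣ pᵢ ≥ j + 1 }
conjPart : List ℕ → ℕ → ℕ
conjPart ps j = length (filter (suc j ℕ.≤?_) ps)

private
  conjPart-decreasing : ∀ ps j → conjPart ps j ≥ conjPart ps (suc j)
  conjPart-decreasing []       j = z≤n
  conjPart-decreasing (p ∷ ps) j with suc (suc j) ℕ.≤? p | suc j ℕ.≤? p
  ... | yes q | yes r
    rewrite List.filter-accept (suc (suc j) ℕ.≤?_) {p} {ps} q
          | List.filter-accept (suc j ℕ.≤?_) {p} {ps} r = s≤s (conjPart-decreasing ps j)
  ... | yes q | no ¬r = ⊥-elim (¬r (ℕ.<⇒≤ q))
  ... | no ¬q | yes r
    rewrite List.filter-reject (suc (suc j) ℕ.≤?_) {p} {ps} ¬q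
          | List.filter-accept (suc j ℕ.≤?_) {p} {ps} r = ℕ.m≤n⇒m≤1+n (conjPart-decreasing ps j)
  ... | no ¬q | no ¬r
    rewrite List.filter-reject (suc (suc j) ℕ.≤?_) {p} {ps} ¬q
          | List.filter-reject (suc j ℕ.≤?_) {p} {ps} ¬r = conjPart-decreasing ps j

  conjPart-positive : ∀ ps {j} → j < nth ps 0 → 0 < conjPart ps j
  conjPart-positive (p ∷ ps) {j} j<p
    rewrite List.filter-accept (suc j ℕ.≤?_) {p} {ps} j<p = z<s

-- The conjugate has μ₁ nonzero parts.
conjugate : Partition → Partition
conjugate μ = record
  { parts      = applyUpTo (conjPart (parts μ)) (part μ 0)
  ; decreasing = Linked.applyUpTo⁺₂ _ _ (conjPart-decreasing (parts μ))
  ; positive   = All.applyUpTo⁺₁ _ _ (conjPart-positive (parts μ))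
  }

-- Extension of a sequence a₀, a₁, … by aₙ = 0 for n < 0.
_at_ : (ℕ → Λ) → ℤ → Λ
a at (+ n)    = a n
a at -[1+ n ] = constΛ 0ℚ

-- The n × n determinant det (a_{μᵢ + j - i}).  The offset j - i does not depend
-- on whether rows and columns are numbered from 0 or from 1.
jacobiTrudi : (ℕ → Λ) → Partition → (n : ℕ) → Λ
jacobiTrudi a μ n =
  det {n} λ i j → a at (+ part μ (toℕ i) ℤ.+ + toℕ j ℤ.- + toℕ i)
  where open RawRingOps Λ-rawRing

module Submission where

-- Write R(z) and C(z) for the two generating functions.  For each variable x
-- the factor 1/(1 - f(z) x) of R(z) is inverse to the factor 1 - f(z) x of
-- C(-z).  Hence R(z) C(-z) = 1, equivalently R(-z) C(z) = 1 (twist-r*c): the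
-- products over the first M variables satisfy this exactly, and each
-- coefficient of a product of series is determined by finitely many
-- coefficients of the factors, so the relation passes to the limit.  Since f
-- has no constant term, c₀ = 1 (c-zero).
--
-- The rest holds in every commutative ring (jacobiTrudi-duality).  The
-- triangular Toeplitz matrices (r_{j-i}) and ((-1)^{j-i} c_{j-i}) are inverse
-- to each other, and the two Jacobi-Trudi determinants are complementary
-- minors of them.  A partition in an n × m box is encoded by a word with n
-- letters true and m letters false, the lattice path bounding its diagram; the
-- positions of the letters true give the rows of det (r_{λᵢ+j-i}), those of the
-- letters false the rows of det (c_{λ′ᵢ+j-i}) (boundaryWord).
--
-- That the minors agree (complementary-minors) is proved by induction on n.
-- Expanding det (r_{λᵢ+j-i}) along the first column gives a signed sum over the
-- words with one letter true, at position p say, turned into false, with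
-- coefficients r_{p-n+1} (expand-trues).  On the other side, the relation
-- R(-z) C(z) = 1 says that a signed sum of rows of c's with these coefficients
-- is the row 1, 0, 0, …  Put this row on top of the determinant of c's: expansion
-- along it gives back det (c_{λ′ᵢ+j-i}), while linearity gives a sum over all
-- positions p, in which the positions of letters false contribute
-- determinants with a repeated row, and the other positions the determinants
-- of the words with one letter changed (insert-falses).  So both sides satisfy
-- the same recursion; for n = 0 the determinant of c's is unitriangular.

open import Algebra.Bundles using (CommutativeRing)
open import Algebra.Bundles.Raw using (RawRing)
import Algebra.Morphism.RingMonomorphism as RingMonomorphism
open import Algebra.Morphism.Structures using (IsRingMonomorphism)
import Algebra.Properties.CommutativeMonoid.Sum as SumProperties
import Algebra.Properties.Ring as RingProperties
import Algebra.Properties.Semiring.Exp as ExpProperties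
import Algebra.Properties.Semiring.Sum as SemiringSumProperties
import Algebra.Solver.Ring.NaturalCoefficients.Default as SemiringSolver
open import Algebra.Structures using (IsCommutativeRing)
open import Data.Bool.Base using (Bool; true; false)
open import Data.Fin.Base as Fin using (Fin; toℕ; punchIn)
import Data.Fin.Properties as Fin
open import Data.Integer.Base as ℤ using (+_)
import Data.Integer.Properties as ℤ
open import Data.List.Base using (List; []; _∷_; _++_; map; length; tabulate; applyUpTo; [_])
import Data.List.Properties as List
open import Data.List.Relation.Binary.Pointwise as Pointwise using (Pointwise; []; _∷_)
import Data.List.Relation.Unary.All.Properties as All
open import Data.List.Relation.Unary.Linked using (Linked; []; [-]; _∷_)
open import Data.Nat.Base as ℕ using (ℕ; zero; suc; _∸_; _≤_; _<_; _≥_; z≤n; s≤s; z<s; s<s)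
import Data.Nat.Properties as ℕ
open import Data.Nat.Tactic.RingSolver using (solve-∀)
open import Data.Product.Base using (∃; _,_)
open import Data.Rational.Base as ℚ using (ℚ; 0ℚ; 1ℚ)
import Data.Rational.Properties as ℚ
open import Data.Vec.Base using (Vec; []; _∷_)
open import Function.Base using (_∘_; id)
open import Level using (Level; 0ℓ; _⊔_)
import Relation.Binary.PropositionalEquality as ≡
open ≡ using (_≡_; _≗_)
import Relation.Binary.Reasoning.Setoid as SetoidReasoning
open import Relation.Nullary.Decidable.Core using (yes; no)
open import Defs

-- Finite sums and signs in commutative rings

module RingFacts {c ℓ : Level} (R : CommutativeRing c ℓ) where
  open CommutativeRing R hiding (_-_; zero)
  open RawRingOps rawRing using (∑; _^_)
  open SumProperties +-commutativeMonoid using (sum-cong-≋; sum-replicate-zero)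
  open ExpProperties semiring using (^-homo-*)
  open RingProperties ring using (-‿involutive; -1*x≈-x)
  open SetoidReasoning setoid

  ∑-zero : ∀ {n} {v : Fin n → Carrier} → (∀ i → v i ≈ 0#) → ∑ v ≈ 0#
  ∑-zero {n} v≈0 = trans (sum-cong-≋ v≈0) (sum-replicate-zero n)

  -- Terms that vanish from index m on do not contribute.
  ∑-truncate : ∀ {m n} {f : ℕ → Carrier} → m ≤ n → (∀ k → m ≤ k → f k ≈ 0#) →
    ∑ {n} (f ∘ toℕ) ≈ ∑ {m} (f ∘ toℕ)
  ∑-truncate {n = n} z≤n f≈0 = ∑-zero {n} λ i → f≈0 (toℕ i) z≤n
  ∑-truncate (s≤s m≤n) f≈0 = +-congˡ (∑-truncate m≤n λ k → f≈0 (suc k) ∘ s≤s)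

  sign : ℕ → Carrier
  sign n = (- 1#) ^ n

  sign-suc : ∀ n → sign (suc n) ≈ - sign n
  sign-suc n = -1*x≈-x (sign n)

  sign-+ : ∀ m n → sign (m ℕ.+ n) ≈ sign m * sign n
  sign-+ = ^-homo-* (- 1#)

  sign-suc-suc : ∀ n → sign (suc (suc n)) ≈ sign n
  sign-suc-suc n = begin
    sign (suc (suc n))  ≈⟨ sign-suc (suc n) ⟩
    - sign (suc n)      ≈⟨ -‿cong (sign-suc n) ⟩
    - - sign n          ≈⟨ -‿involutive (sign n) ⟩
    sign n              ∎

  sign-double : ∀ n → sign (n ℕ.+ n) ≈ 1#
  sign-double zero    = refl
  sign-double (suc n) = begin
    sign (suc (n ℕ.+ suc n))    ≡⟨ ≡.cong (sign ∘ suc) (ℕ.+-suc n n) ⟩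
    sign (suc (suc (n ℕ.+ n)))  ≈⟨ sign-suc-suc (n ℕ.+ n) ⟩
    sign (n ℕ.+ n)              ≈⟨ sign-double n ⟩
    1#                          ∎

  sign² : ∀ n → sign n * sign n ≈ 1#
  sign² n = trans (sym (sign-+ n n)) (sign-double n)

-- Rings of formal power series

-- Formal power series over R: the Cauchy product satisfies the recursion
-- (u ⋆ v) (suc n) = u 0 * v (suc n) + ((u ∘ suc) ⋆ v) n, which holds by
-- computation, and every ring law follows from it by induction on n.
module PowerSeries {c ℓ : Level} (R : CommutativeRing c ℓ) where
  open CommutativeRing R hiding (_-_; zero)
  open RawRingOps rawRing using (∑)
  open SumProperties +-commutativeMonoid using (sum-cong-≋)
  open SemiringSumProperties semiring using (*-distribˡ-sum)
  open SemiringSolver commutativeSemiring using (solve; _:+_; _:*_; _:=_; con)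
  open SetoidReasoning setoid
  open RingFacts R

  Series : Set c
  Series = ℕ → Carrier

  private module S = RawRing (rawRing ⟦z⟧)
  open S using () renaming (_≈_ to _≋_; _+_ to _⊕_; _*_ to _⋆_; 1# to 𝟏)

  ⋆-cong-≤ : ∀ {u u′ v v′} n → (∀ k → k ≤ n → u k ≈ u′ k) →
    (∀ k → k ≤ n → v k ≈ v′ k) → (u ⋆ v) n ≈ (u′ ⋆ v′) n
  ⋆-cong-≤ n u≈ v≈ = sum-cong-≋ {suc n} λ i →
    *-cong (u≈ (toℕ i) (Fin.toℕ≤pred[n] i)) (v≈ (n ∸ toℕ i) (ℕ.m∸n≤m n (toℕ i)))

  ⋆-cong : ∀ {u u′ v v′} → u ≋ u′ → v ≋ v′ → u ⋆ v ≋ u′ ⋆ v′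
  ⋆-cong u≈ v≈ n = ⋆-cong-≤ n (λ k _ → u≈ k) (λ k _ → v≈ k)

  ⋆-zeroˡ-≤ : ∀ u v n → (∀ k → k ≤ n → u k ≈ 0#) → (u ⋆ v) n ≈ 0#
  ⋆-zeroˡ-≤ u v n u≈0 = ∑-zero {suc n} λ i →
    trans (*-congʳ (u≈0 (toℕ i) (Fin.toℕ≤pred[n] i))) (zeroˡ (v (n ∸ toℕ i)))

  ⋆-zeroʳ-≤ : ∀ u v n → (∀ k → k ≤ n → v k ≈ 0#) → (u ⋆ v) n ≈ 0#
  ⋆-zeroʳ-≤ u v n v≈0 = ∑-zero {suc n} λ i →
    trans (*-congˡ (v≈0 (n ∸ toℕ i) (ℕ.m∸n≤m n (toℕ i)))) (zeroʳ (u (toℕ i)))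

  -- The mirror image of the recursion, splitting off the last term.
  ⋆-suc′ : ∀ n u v → (u ⋆ v) (suc n) ≈ u (suc n) * v 0 + (u ⋆ (v ∘ suc)) n
  ⋆-suc′ zero u v = solve 4
    (λ u₀ u₁ v₀ v₁ → u₀ :* v₁ :+ (u₁ :* v₀ :+ con 0) := u₁ :* v₀ :+ (u₀ :* v₁ :+ con 0))
    refl (u 0) (u 1) (v 0) (v 1)
  ⋆-suc′ (suc n) u v = trans (+-congˡ (⋆-suc′ n (u ∘ suc) v))
    (solve 3 (λ a b c → a :+ (b :+ c) := b :+ (a :+ c)) refl
      (u 0 * v (2 ℕ.+ n)) (u (2 ℕ.+ n) * v 0) (((u ∘ suc) ⋆ (v ∘ suc)) n))

  ⋆-comm : ∀ u v → u ⋆ v ≋ v ⋆ u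
  ⋆-comm u v zero    = +-congʳ (*-comm (u 0) (v 0))
  ⋆-comm u v (suc n) = trans
    (+-cong (*-comm (u 0) (v (suc n))) (⋆-comm (u ∘ suc) v n))
    (sym (⋆-suc′ n v u))

  ⋆-scale : ∀ a u v n → ((λ k → a * u k) ⋆ v) n ≈ a * (u ⋆ v) n
  ⋆-scale a u v zero = solve 3 (λ a b c → a :* b :* c :+ con 0 := a :* (b :* c :+ con 0))
    refl a (u 0) (v 0)
  ⋆-scale a u v (suc n) = trans (+-congˡ (⋆-scale a (u ∘ suc) v n))
    (solve 4 (λ a b c d → a :* b :* c :+ a :* d := a :* (b :* c :+ d)) refl
      a (u 0) (v (suc n)) (((u ∘ suc) ⋆ v) n))

  ⋆-distribʳ : ∀ w u v → (u ⊕ v) ⋆ w ≋ (u ⋆ w) ⊕ (v ⋆ w)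
  ⋆-distribʳ w u v zero = solve 3
    (λ u v w → (u :+ v) :* w :+ con 0 := (u :* w :+ con 0) :+ (v :* w :+ con 0))
    refl (u 0) (v 0) (w 0)
  ⋆-distribʳ w u v (suc n) = trans (+-congˡ (⋆-distribʳ w (u ∘ suc) (v ∘ suc) n))
    (solve 5 (λ u v w a b → (u :+ v) :* w :+ (a :+ b) := (u :* w :+ a) :+ (v :* w :+ b)) refl
      (u 0) (v 0) (w (suc n)) (((u ∘ suc) ⋆ w) n) (((v ∘ suc) ⋆ w) n))

  ⋆-distribˡ : ∀ w u v → w ⋆ (u ⊕ v) ≋ (w ⋆ u) ⊕ (w ⋆ v)
  ⋆-distribˡ w u v n = begin
    (w ⋆ (u ⊕ v)) n          ≈⟨ ⋆-comm w (u ⊕ v) n ⟩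
    ((u ⊕ v) ⋆ w) n          ≈⟨ ⋆-distribʳ w u v n ⟩
    (u ⋆ w) n + (v ⋆ w) n    ≈⟨ +-cong (⋆-comm u w n) (⋆-comm v w n) ⟩
    (w ⋆ u) n + (w ⋆ v) n    ∎

  ⋆-assoc : ∀ u v w → (u ⋆ v) ⋆ w ≋ u ⋆ (v ⋆ w)
  ⋆-assoc u v w zero = solve 3
    (λ u v w → (u :* v :+ con 0) :* w :+ con 0 := u :* (v :* w :+ con 0) :+ con 0)
    refl (u 0) (v 0) (w 0)
  ⋆-assoc u v w (suc n) = begin
    (u 0 * v 0 + 0#) * w (suc n) + (((λ k → u 0 * v (suc k)) ⊕ ((u ∘ suc) ⋆ v)) ⋆ w) n
      ≈⟨ +-congˡ (⋆-distribʳ w (λ k → u 0 * v (suc k)) ((u ∘ suc) ⋆ v) n) ⟩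
    (u 0 * v 0 + 0#) * w (suc n)
      + (((λ k → u 0 * v (suc k)) ⋆ w) n + (((u ∘ suc) ⋆ v) ⋆ w) n)
      ≈⟨ +-congˡ (+-cong (⋆-scale (u 0) (v ∘ suc) w n) (⋆-assoc (u ∘ suc) v w n)) ⟩
    (u 0 * v 0 + 0#) * w (suc n) + (u 0 * ((v ∘ suc) ⋆ w) n + ((u ∘ suc) ⋆ (v ⋆ w)) n)
      ≈⟨ solve 5 (λ u v w a b → (u :* v :+ con 0) :* w :+ (u :* a :+ b)
                    := u :* (v :* w :+ a) :+ b) refl
           (u 0) (v 0) (w (suc n)) (((v ∘ suc) ⋆ w) n) (((u ∘ suc) ⋆ (v ⋆ w)) n) ⟩
    u 0 * (v ⋆ w) (suc n) + ((u ∘ suc) ⋆ (v ⋆ w)) n ∎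

  ⋆-identityˡ : ∀ u → 𝟏 ⋆ u ≋ u
  ⋆-identityˡ u zero    = trans (+-identityʳ _) (*-identityˡ _)
  ⋆-identityˡ u (suc n) = begin
    1# * u (suc n) + ((λ _ → 0#) ⋆ u) n ≈⟨ +-cong (*-identityˡ _) (⋆-zeroˡ-≤ (λ _ → 0#) u n λ _ _ → refl) ⟩
    u (suc n) + 0#                      ≈⟨ +-identityʳ _ ⟩
    u (suc n)                           ∎

  powerSeriesRing : CommutativeRing c ℓ
  powerSeriesRing = record
    { isCommutativeRing = record
      { isRing = record
        { +-isAbelianGroup = record
          { isGroup = record
            { isMonoid = record
              { isSemigroup = record
                { isMagma = record
                  { isEquivalence = record
                    { refl  = λ _ → refl
                    ; sym   = λ p n → sym (p n)
                    ; trans = λ p q n → trans (p n) (q n)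
                    }
                  ; ∙-cong = λ p q n → +-cong (p n) (q n)
                  }
                ; assoc = λ u v w n → +-assoc (u n) (v n) (w n)
                }
              ; identity = (λ u n → +-identityˡ (u n)) , (λ u n → +-identityʳ (u n))
              }
            ; inverse = (λ u n → -‿inverseˡ (u n)) , (λ u n → -‿inverseʳ (u n))
            ; ⁻¹-cong = λ p n → -‿cong (p n)
            }
          ; comm = λ u v n → +-comm (u n) (v n)
          }
        ; *-cong     = ⋆-cong
        ; *-assoc    = ⋆-assoc
        ; *-identity = ⋆-identityˡ , λ u n → trans (⋆-comm u 𝟏 n) (⋆-identityˡ u n)
        ; distrib    = ⋆-distribˡ , ⋆-distribʳ
        }
      ; *-comm = ⋆-comm
      }
    }

  open RawRingOps (rawRing ⟦z⟧) using (_^_) renaming (∑ to ∑ᶻ; _-_ to _⊖_)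

  ∑ᶻ-coeff : ∀ {k} (v : Fin k → Series) n → ∑ᶻ v n ≈ ∑ λ i → v i n
  ∑ᶻ-coeff {zero}  v n = refl
  ∑ᶻ-coeff {suc k} v n = +-congˡ (∑ᶻ-coeff (v ∘ Fin.suc) n)

  -- The substitution z ↦ -z.
  twist : Series → Series
  twist u n = sign n * u n

  twist-⋆ : ∀ u v → twist (u ⋆ v) ≋ twist u ⋆ twist v
  twist-⋆ u v n = trans
    (*-distribˡ-sum {suc n} (sign n) (λ i → u (toℕ i) * v (n ∸ toℕ i)))
    (sum-cong-≋ {suc n} λ i → begin
      sign n * (u (toℕ i) * v (n ∸ toℕ i))
        ≡⟨ ≡.cong (λ m → sign m * (u (toℕ i) * v (n ∸ toℕ i))) (ℕ.m+[n∸m]≡n (Fin.toℕ≤pred[n] i)) ⟨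
      sign (toℕ i ℕ.+ (n ∸ toℕ i)) * (u (toℕ i) * v (n ∸ toℕ i))
        ≈⟨ *-congʳ (sign-+ (toℕ i) (n ∸ toℕ i)) ⟩
      sign (toℕ i) * sign (n ∸ toℕ i) * (u (toℕ i) * v (n ∸ toℕ i))
        ≈⟨ solve 4 (λ a b c d → a :* b :* (c :* d) := a :* c :* (b :* d)) refl
             (sign (toℕ i)) (sign (n ∸ toℕ i)) (u (toℕ i)) (v (n ∸ toℕ i)) ⟩
      twist u (toℕ i) * twist v (n ∸ toℕ i) ∎)

  twist-involutive : ∀ u → twist (twist u) ≋ u
  twist-involutive u n = begin
    sign n * (sign n * u n)  ≈⟨ *-assoc _ _ _ ⟨
    sign n * sign n * u n    ≈⟨ *-congʳ (sign² n) ⟩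
    1# * u n                 ≈⟨ *-identityˡ _ ⟩
    u n                      ∎

  twist-𝟏 : twist 𝟏 ≋ 𝟏
  twist-𝟏 zero    = *-identityˡ 1#
  twist-𝟏 (suc n) = zeroʳ _

  twist-cong : ∀ {u v} → u ≋ v → twist u ≋ twist v
  twist-cong u≋v n = *-congˡ (u≋v n)

  -- 1/(1-u), for u without constant term; the sum is cut off at k = n because
  -- u^k then has no coefficient below k.
  geometric : Series → Series
  geometric u n = ∑ {suc n} λ k → (u ^ toℕ k) n

  module _ (u : Series) (u₀≈0 : u 0 ≈ 0#) where
    private module SR = CommutativeRing powerSeriesRing
    open SemiringSumProperties SR.semiring using () renaming (*-distribˡ-sum to ⋆-distribˡ-∑ᶻ)

    ⋆-shift : ∀ v n → (u ⋆ v) (suc n) ≈ ((u ∘ suc) ⋆ v) n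
    ⋆-shift v n = trans (+-congʳ (trans (*-congʳ u₀≈0) (zeroˡ _))) (+-identityˡ _)

    ⋆-zero : ∀ v → (u ⋆ v) 0 ≈ 0#
    ⋆-zero v = trans (+-identityʳ _) (trans (*-congʳ u₀≈0) (zeroˡ _))

    ^-order : ∀ k n → n < k → (u ^ k) n ≈ 0#
    ^-order (suc k) zero    _           = ⋆-zero (u ^ k)
    ^-order (suc k) (suc n) (s≤s n<k) = trans (⋆-shift (u ^ k) n)
      (⋆-zeroʳ-≤ (u ∘ suc) (u ^ k) n λ j j≤n → ^-order k j (ℕ.≤-<-trans j≤n n<k))

    private
      partialSum : ℕ → Series
      partialSum K = ∑ᶻ {K} λ k → u ^ toℕ k

      partialSum-stable : ∀ K n → n < K → partialSum K n ≈ geometric u n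
      partialSum-stable K n n<K = trans (∑ᶻ-coeff {K} (λ k → u ^ toℕ k) n)
        (∑-truncate {f = λ k → (u ^ k) n} n<K λ k → ^-order k n)

      -- Since u has no constant term, the left-hand coefficient involves
      -- only coefficients below n of the second factor, where the partial
      -- sum already agrees with the whole series.
      ⋆-partialSum : ∀ n → (u ⋆ partialSum n) n ≈ (u ⋆ geometric u) n
      ⋆-partialSum zero    = trans (⋆-zero (partialSum 0)) (sym (⋆-zero (geometric u)))
      ⋆-partialSum (suc n) = begin
        (u ⋆ partialSum (suc n)) (suc n)    ≈⟨ ⋆-shift (partialSum (suc n)) n ⟩
        ((u ∘ suc) ⋆ partialSum (suc n)) n  ≈⟨ ⋆-cong-≤ {u ∘ suc} n (λ _ _ → refl)
                                                 (λ k k≤n → partialSum-stable (suc n) k (s≤s k≤n)) ⟩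
        ((u ∘ suc) ⋆ geometric u) n         ≈⟨ ⋆-shift (geometric u) n ⟨
        (u ⋆ geometric u) (suc n)           ∎

    geometric-step : geometric u ≋ 𝟏 ⊕ (u ⋆ geometric u)
    geometric-step n = +-congˡ (begin
      ∑ {n} (λ k → (u ⋆ (u ^ toℕ k)) n)   ≈⟨ ∑ᶻ-coeff {n} (λ k → u ⋆ (u ^ toℕ k)) n ⟨
      ∑ᶻ {n} (λ k → u ⋆ (u ^ toℕ k)) n    ≈⟨ ⋆-distribˡ-∑ᶻ {n} u (λ k → u ^ toℕ k) n ⟨
      (u ⋆ partialSum n) n                ≈⟨ ⋆-partialSum n ⟩
      (u ⋆ geometric u) n                 ∎)

    geometric-inverse : geometric u ⋆ (𝟏 ⊖ u) ≋ 𝟏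
    geometric-inverse n = begin
      (g ⋆ (𝟏 ⊖ u)) n                      ≈⟨ ⋆-comm g (𝟏 ⊖ u) n ⟩
      ((𝟏 ⊖ u) ⋆ g) n                      ≈⟨ ⋆-distribʳ g 𝟏 (S.- u) n ⟩
      (𝟏 ⋆ g) n + ((S.- u) ⋆ g) n          ≈⟨ +-cong (trans (⋆-identityˡ g n) (geometric-step n))
                                                (sym (-‿distribˡ-⋆ u g n)) ⟩
      (𝟏 n + (u ⋆ g) n) + (- (u ⋆ g) n)    ≈⟨ +-assoc _ _ _ ⟩
      𝟏 n + ((u ⋆ g) n + (- (u ⋆ g) n))    ≈⟨ +-congˡ (-‿inverseʳ _) ⟩
      𝟏 n + 0#                             ≈⟨ +-identityʳ _ ⟩
      𝟏 n                                  ∎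
      where
      open RingProperties SR.ring using () renaming (-‿distribˡ-* to -‿distribˡ-⋆)
      g = geometric u

-- The ring of series in infinitely many variables

-- ℚ[[x₀, …, xₗ₋₁]], as an iterated power series ring.
ℚ⟦x⟧ : ℕ → CommutativeRing 0ℓ 0ℓ
ℚ⟦x⟧ zero    = ℚ.+-*-commutativeRing
ℚ⟦x⟧ (suc l) = PowerSeries.powerSeriesRing (ℚ⟦x⟧ l)

private
  module K (l : ℕ) where
    open CommutativeRing (ℚ⟦x⟧ l) public
    open RawRingOps rawRing public using (∑)
  module ℚ∑ = RawRingOps ℚ.+-*-rawRing

-- The part of a series given by the exponent lists of length l.  These parts
-- multiply independently of each other, each as power series in l variables,
-- whether or not they fit together (padding is not required).
restrict : ∀ l → ℚ⟦X⟧ → K.Carrier l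
restrict zero    F   = F []
restrict (suc l) F k = restrict l (slice F k)

restrict-cong : ∀ l {F G} → F ≗ G → K._≈_ l (restrict l F) (restrict l G)
restrict-cong zero    F≗G   = F≗G []
restrict-cong (suc l) F≗G k = restrict-cong l (F≗G ∘ (k ∷_))

restrict-injective : ∀ {F G} → (∀ l → K._≈_ l (restrict l F) (restrict l G)) → F ≗ G
restrict-injective eq []      = eq zero
restrict-injective eq (k ∷ α) = restrict-injective (λ l → eq (suc l) k) α

restrict-+ : ∀ l F G → K._≈_ l (restrict l (F +X G)) (K._+_ l (restrict l F) (restrict l G))
restrict-+ zero    F G   = ≡.refl
restrict-+ (suc l) F G k = restrict-+ l (slice F k) (slice G k)

restrict-neg : ∀ l F → K._≈_ l (restrict l (-X F)) (K.-_ l (restrict l F))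
restrict-neg zero    F   = ≡.refl
restrict-neg (suc l) F k = restrict-neg l (slice F k)

restrict-zero : ∀ l → K._≈_ l (restrict l (λ _ → 0ℚ)) (K.0# l)
restrict-zero zero      = ≡.refl
restrict-zero (suc l) k = restrict-zero l

constX-zero : constX 0ℚ ≗ λ _ → 0ℚ
constX-zero []          = ≡.refl
constX-zero (zero  ∷ α) = constX-zero α
constX-zero (suc _ ∷ α) = ≡.refl

restrict-0# : ∀ l → K._≈_ l (restrict l (constX 0ℚ)) (K.0# l)
restrict-0# l = K.trans l (restrict-cong l constX-zero) (restrict-zero l)

restrict-1# : ∀ l → K._≈_ l (restrict l (constX 1ℚ)) (K.1# l)
restrict-1# zero            = ≡.refl
restrict-1# (suc l) zero    = restrict-1# l
restrict-1# (suc l) (suc k) = restrict-zero l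

restrict-∑ : ∀ l {n} (v : Fin n → ℚ⟦X⟧) →
  K._≈_ l (restrict l (λ α → ℚ∑.∑ λ i → v i α)) (K.∑ l λ i → restrict l (v i))
restrict-∑ l {zero}  v = restrict-zero l
restrict-∑ l {suc n} v = K.trans l
  (restrict-+ l (v Fin.zero) (λ α → ℚ∑.∑ λ i → v (Fin.suc i) α))
  (K.+-congˡ l (restrict-∑ l (v ∘ Fin.suc)))

restrict-* : ∀ l F G → K._≈_ l (restrict l (F *X G)) (K._*_ l (restrict l F) (restrict l G))
restrict-* zero    F G   = ≡.refl
restrict-* (suc l) F G k = K.trans l
  (restrict-∑ l {suc k} λ i → slice F (toℕ i) *X slice G (k ∸ toℕ i))
  (sum-cong-≋ {suc k} λ i → restrict-* l (slice F (toℕ i)) (slice G (k ∸ toℕ i)))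
  where open SumProperties (K.+-commutativeMonoid l) using (sum-cong-≋)

private
  -- The ring laws up to equality on the exponent lists of length l.
  module Laws (l : ℕ) where
    ℚ⟦X⟧ˡ : RawRing 0ℓ 0ℓ
    ℚ⟦X⟧ˡ = record
      { Carrier = ℚ⟦X⟧
      ; _≈_ = λ F G → K._≈_ l (restrict l F) (restrict l G)
      ; _+_ = _+X_ ; _*_ = _*X_ ; -_ = -X_ ; 0# = constX 0ℚ ; 1# = constX 1ℚ
      }

    isMonomorphism : IsRingMonomorphism ℚ⟦X⟧ˡ (K.rawRing l) (restrict l)
    isMonomorphism = record
      { isRingHomomorphism = record
        { isSemiringHomomorphism = record
          { isNearSemiringHomomorphism = record
            { +-isMonoidHomomorphism = record
              { isMagmaHomomorphism = record
                { isRelHomomorphism = record { cong = id }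
                ; homo = restrict-+ l
                }
              ; ε-homo = restrict-0# l
              }
            ; *-homo = restrict-* l
            }
          ; 1#-homo = restrict-1# l
          }
        ; -‿homo = restrict-neg l
        }
      ; injective = id
      }

    open IsCommutativeRing
      (RingMonomorphism.isCommutativeRing isMonomorphism (K.isCommutativeRing l)) public

ℚ⟦X⟧-ring : CommutativeRing 0ℓ 0ℓ
ℚ⟦X⟧-ring = record
  { Carrier = ℚ⟦X⟧ ; _≈_ = _≗_
  ; _+_ = _+X_ ; _*_ = _*X_ ; -_ = -X_ ; 0# = constX 0ℚ ; 1# = constX 1ℚ
  ; isCommutativeRing = record
    { isRing = record
      { +-isAbelianGroup = record
        { isGroup = record
          { isMonoid = record
            { isSemigroup = record
              { isMagma = record
                { isEquivalence = record
                  { refl  = λ _ → ≡.refl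
                  ; sym   = λ p α → ≡.sym (p α)
                  ; trans = λ p q α → ≡.trans (p α) (q α)
                  }
                ; ∙-cong = λ p q α → ≡.cong₂ ℚ._+_ (p α) (q α)
                }
              ; assoc = λ F G H → restrict-injective λ l → Laws.+-assoc l F G H
              }
            ; identity = (λ F → restrict-injective λ l → Laws.+-identityˡ l F)
                       , (λ F → restrict-injective λ l → Laws.+-identityʳ l F)
            }
          ; inverse = (λ F → restrict-injective λ l → Laws.-‿inverseˡ l F)
                    , (λ F → restrict-injective λ l → Laws.-‿inverseʳ l F)
          ; ⁻¹-cong = λ p α → ≡.cong ℚ.-_ (p α)
          }
        ; comm = λ F G → restrict-injective λ l → Laws.+-comm l F G
        }
      ; *-cong     = λ {F} {F′} {G} {G′} p q → restrict-injective λ l →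
          Laws.*-cong l {F} {F′} {G} {G′} (restrict-cong l p) (restrict-cong l q)
      ; *-assoc    = λ F G H → restrict-injective λ l → Laws.*-assoc l F G H
      ; *-identity = (λ F → restrict-injective λ l → Laws.*-identityˡ l F)
                   , (λ F → restrict-injective λ l → Laws.*-identityʳ l F)
      ; distrib    = (λ F G H → restrict-injective λ l → Laws.distribˡ l F G H)
                   , (λ F G H → restrict-injective λ l → Laws.distribʳ l F G H)
      }
    ; *-comm = λ F G → restrict-injective λ l → Laws.*-comm l F G
    }
  }

-- Determinants as alternating functions of rows

module Determinants {c ℓ : Level} (R : CommutativeRing c ℓ) where
  open CommutativeRing R hiding (_-_; zero)
  open RawRingOps rawRing using (∑; det)
  open SumProperties +-commutativeMonoid using (sum-cong-≋; ∑-comm)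
  open SemiringSumProperties semiring using (*-distribˡ-sum)
  open SemiringSolver commutativeSemiring using (solve; _:+_; _:*_; _:=_)
  open RingProperties ring
    using (-‿distribˡ-*; -‿distribʳ-*; -‿+-comm; -0#≈0#; +-inverseʳ-unique; x+x≈x⇒x≈0)
  open SetoidReasoning setoid
  open RingFacts R

  ∑-neg : ∀ {n} (v : Fin n → Carrier) → ∑ (λ i → - v i) ≈ - ∑ v
  ∑-neg {zero}  v = sym -0#≈0#
  ∑-neg {suc n} v = trans (+-congˡ (∑-neg (v ∘ Fin.suc))) (-‿+-comm _ _)

  det-cong : ∀ {n} {M M′ : Fin n → Fin n → Carrier} → (∀ i j → M i j ≈ M′ i j) → det M ≈ det M′
  det-cong {zero}  eq = refl
  det-cong {suc n} eq = sum-cong-≋ λ j → *-cong (*-congˡ {sign (toℕ j)} (eq Fin.zero j))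
    (det-cong λ i k → eq (Fin.suc i) (punchIn j k))

  -- Laplace expansion along the first column.  Apart from the term of the
  -- corner, it becomes by induction the same double sum as the expansion along
  -- the first row: over an entry of the first row and one of the first column.
  det-column : ∀ {n} (M : Fin (suc n) → Fin (suc n) → Carrier) →
    det M ≈ ∑ λ i → sign (toℕ i) * M i Fin.zero * det (λ k l → M (punchIn i k) (Fin.suc l))
  det-column {zero}  M = refl
  det-column {suc n} M = +-congˡ (begin
    ∑ (λ j → sign (suc (toℕ j)) * M Fin.zero (Fin.suc j)
               * det (λ i k → M (Fin.suc i) (punchIn (Fin.suc j) k)))
      ≈⟨ sum-cong-≋ (λ j → trans
           (*-congˡ {a j} (det-column λ i k → M (Fin.suc i) (punchIn (Fin.suc j) k)))
           (*-distribˡ-sum (a j) λ i → sign (toℕ i) * M (Fin.suc i) Fin.zero * minor i j)) ⟩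
    ∑ (λ j → ∑ λ i → sign (suc (toℕ j)) * M Fin.zero (Fin.suc j)
               * (sign (toℕ i) * M (Fin.suc i) Fin.zero * minor i j))
      ≈⟨ ∑-comm (λ j i → sign (suc (toℕ j)) * M Fin.zero (Fin.suc j)
               * (sign (toℕ i) * M (Fin.suc i) Fin.zero * minor i j)) ⟩
    ∑ (λ i → ∑ λ j → sign (suc (toℕ j)) * M Fin.zero (Fin.suc j)
               * (sign (toℕ i) * M (Fin.suc i) Fin.zero * minor i j))
      ≈⟨ sum-cong-≋ (λ i → sum-cong-≋ λ j → solve 6
           (λ o s t a b d → o :* s :* a :* (t :* b :* d) := o :* t :* b :* (s :* a :* d)) refl
           (- 1#) (sign (toℕ j)) (sign (toℕ i)) (M Fin.zero (Fin.suc j))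
           (M (Fin.suc i) Fin.zero) (minor i j)) ⟩
    ∑ (λ i → ∑ λ j → sign (suc (toℕ i)) * M (Fin.suc i) Fin.zero
               * (sign (toℕ j) * M Fin.zero (Fin.suc j) * minor i j))
      ≈⟨ sum-cong-≋ (λ i → *-distribˡ-sum (b i) λ j →
           sign (toℕ j) * M Fin.zero (Fin.suc j) * minor i j) ⟨
    ∑ (λ i → sign (suc (toℕ i)) * M (Fin.suc i) Fin.zero
               * det (λ k l → M (punchIn (Fin.suc i) k) (Fin.suc l))) ∎)
    where
    a b : Fin (suc n) → Carrier
    a j = sign (suc (toℕ j)) * M Fin.zero (Fin.suc j)
    b i = sign (suc (toℕ i)) * M (Fin.suc i) Fin.zero
    minor : Fin (suc n) → Fin (suc n) → Carrier
    minor i j = det λ k l → M (Fin.suc (punchIn i k)) (Fin.suc (punchIn j l))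

  -- A row of a matrix with infinitely many columns.
  Row : Set c
  Row = ℕ → Carrier

  infix 4 _≋_
  _≋_ : Row → Row → Set ℓ
  u ≋ v = ∀ j → u j ≈ v j

  infixl 6 _⊕_
  _⊕_ : Row → Row → Row
  (u ⊕ v) j = u j + v j

  infixl 7 _⊙_
  _⊙_ : Carrier → Row → Row
  (a ⊙ v) j = a * v j

  tail : Row → Row
  tail v = v ∘ suc

  -- ∑ᵢ (-1)ⁱ vᵢ(0) G(v₀, …, vᵢ₋₁, vᵢ₊₁, …)
  expand : (List Row → Carrier) → List Row → Carrier
  expand G []       = 0#
  expand G (v ∷ vs) = v 0 * G vs + (- expand (G ∘ (v ∷_)) vs)

  -- The determinant of the first n columns of a list of n rows, by expansion
  -- along the first column; for a list of another length it is 0.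
  rowsDet : ℕ → List Row → Carrier
  rowsDet zero    []      = 1#
  rowsDet zero    (_ ∷ _) = 0#
  rowsDet (suc n) vs      = expand (rowsDet n ∘ map tail) vs

  expand-cong : ∀ {G H} vs → (∀ us → G us ≈ H us) → expand G vs ≈ expand H vs
  expand-cong []       eq = refl
  expand-cong (v ∷ vs) eq = +-cong (*-congˡ (eq vs)) (-‿cong (expand-cong vs λ us → eq (v ∷ us)))

  expand-zero : ∀ {G} vs → (∀ us → G us ≈ 0#) → expand G vs ≈ 0#
  expand-zero []       eq = refl
  expand-zero (v ∷ vs) eq = begin
    v 0 * _ + (- expand _ vs) ≈⟨ +-cong (trans (*-congˡ (eq vs)) (zeroʳ _))
                                   (trans (-‿cong (expand-zero vs λ us → eq (v ∷ us))) -0#≈0#) ⟩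
    0# + 0#                   ≈⟨ +-identityˡ 0# ⟩
    0#                        ∎

  expand-linear : ∀ a G H vs → expand (λ us → a * G us + H us) vs ≈ a * expand G vs + expand H vs
  expand-linear a G H []       = sym (trans (+-identityʳ _) (zeroʳ a))
  expand-linear a G H (v ∷ vs) = begin
    v 0 * (a * G vs + H vs) + (- expand (λ us → a * G (v ∷ us) + H (v ∷ us)) vs)
      ≈⟨ +-congˡ (-‿cong (expand-linear a (G ∘ (v ∷_)) (H ∘ (v ∷_)) vs)) ⟩
    v 0 * (a * G vs + H vs) + (- (a * G′ + H′))
      ≈⟨ +-congˡ (-‿+-comm _ _) ⟨
    v 0 * (a * G vs + H vs) + (- (a * G′) + (- H′))
      ≈⟨ +-congˡ (+-congʳ (-‿distribʳ-* a G′)) ⟩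
    v 0 * (a * G vs + H vs) + (a * (- G′) + (- H′))
      ≈⟨ solve 6 (λ v a g h g′ h′ → v :* (a :* g :+ h) :+ (a :* g′ :+ h′)
                   := a :* (v :* g :+ g′) :+ (v :* h :+ h′)) refl
           (v 0) a (G vs) (H vs) (- G′) (- H′) ⟩
    a * (v 0 * G vs + (- G′)) + (v 0 * H vs + (- H′)) ∎
    where
    G′ = expand (G ∘ (v ∷_)) vs
    H′ = expand (H ∘ (v ∷_)) vs

  -- Alternating multilinear forms on lists of rows, of any number of arguments.
  record IsAlternating (G : List Row → Carrier) : Set (c ⊔ ℓ) where
    field
      cong   : ∀ {us vs} → Pointwise _≋_ us vs → G us ≈ G vs
      linear : ∀ us a v w vs →
        G (us ++ (a ⊙ v ⊕ w) ∷ vs) ≈ a * G (us ++ v ∷ vs) + G (us ++ w ∷ vs)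
      equal  : ∀ us v vs → G (us ++ v ∷ v ∷ vs) ≈ 0#

  open IsAlternating

  ≋-refl : ∀ {v} → v ≋ v
  ≋-refl _ = refl

  Pointwise-refl : ∀ {vs} → Pointwise _≋_ vs vs
  Pointwise-refl = Pointwise.refl ≋-refl

  ∷-alternating : ∀ {G} → IsAlternating G → ∀ v → IsAlternating (G ∘ (v ∷_))
  ∷-alternating alt v .cong   eq = cong alt (≋-refl ∷ eq)
  ∷-alternating alt v .linear us = linear alt (v ∷ us)
  ∷-alternating alt v .equal  us = equal alt (v ∷ us)

  ++-alternating : ∀ {G} → IsAlternating G → ∀ ws → IsAlternating (λ us → G (us ++ ws))
  ++-alternating alt ws .cong eq = cong alt (Pointwise.++⁺ eq Pointwise-refl)
  ++-alternating alt ws .linear us a v w vs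
    rewrite List.++-assoc us ((a ⊙ v ⊕ w) ∷ vs) ws | List.++-assoc us (v ∷ vs) ws
          | List.++-assoc us (w ∷ vs) ws = linear alt us a v w (vs ++ ws)
  ++-alternating alt ws .equal us v vs
    rewrite List.++-assoc us (v ∷ v ∷ vs) ws = equal alt us v (vs ++ ws)

  map-tail-alternating : ∀ {G} → IsAlternating G → IsAlternating (G ∘ map tail)
  map-tail-alternating alt .cong eq =
    cong alt (Pointwise.map⁺ tail tail (Pointwise.map (λ p → p ∘ suc) eq))
  map-tail-alternating alt .linear us a v w vs
    rewrite List.map-++ tail us ((a ⊙ v ⊕ w) ∷ vs) | List.map-++ tail us (v ∷ vs)
          | List.map-++ tail us (w ∷ vs) = linear alt (map tail us) a (tail v) (tail w) (map tail vs)
  map-tail-alternating alt .equal us v vs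
    rewrite List.map-++ tail us (v ∷ v ∷ vs) = equal alt (map tail us) (tail v) (map tail vs)

  expand-pointwise : ∀ {G} → IsAlternating G → ∀ {us vs} → Pointwise _≋_ us vs → expand G us ≈ expand G vs
  expand-pointwise alt []                   = refl
  expand-pointwise alt {u ∷ us} {v ∷ vs} (p ∷ ps) = +-cong (*-cong (p 0) (cong alt ps)) (-‿cong (trans
    (expand-cong us λ ws → cong alt (p ∷ Pointwise-refl))
    (expand-pointwise (∷-alternating alt v) ps)))

  expand-alternating : ∀ {G} → IsAlternating G → IsAlternating (expand G)
  expand-alternating alt .cong = expand-pointwise alt
  expand-alternating {G} alt .linear [] a v w vs = begin
    (a * v 0 + w 0) * G vs + (- expand (G ∘ ((a ⊙ v ⊕ w) ∷_)) vs)
      ≈⟨ +-congˡ (-‿cong (trans (expand-cong vs (linear alt [] a v w))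
           (expand-linear a (G ∘ (v ∷_)) (G ∘ (w ∷_)) vs))) ⟩
    (a * v 0 + w 0) * G vs + (- (a * Gv + Gw))
      ≈⟨ +-congˡ (-‿+-comm _ _) ⟨
    (a * v 0 + w 0) * G vs + (- (a * Gv) + (- Gw))
      ≈⟨ +-congˡ (+-congʳ (-‿distribʳ-* a Gv)) ⟩
    (a * v 0 + w 0) * G vs + (a * (- Gv) + (- Gw))
      ≈⟨ solve 6 (λ a v w g gv gw → (a :* v :+ w) :* g :+ (a :* gv :+ gw)
                   := a :* (v :* g :+ gv) :+ (w :* g :+ gw)) refl
           a (v 0) (w 0) (G vs) (- Gv) (- Gw) ⟩
    a * (v 0 * G vs + (- Gv)) + (w 0 * G vs + (- Gw)) ∎
    where
    Gv = expand (G ∘ (v ∷_)) vs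
    Gw = expand (G ∘ (w ∷_)) vs
  expand-alternating {G} alt .linear (u ∷ us) a v w vs = begin
    u 0 * G (us ++ (a ⊙ v ⊕ w) ∷ vs) + (- expand (G ∘ (u ∷_)) (us ++ (a ⊙ v ⊕ w) ∷ vs))
      ≈⟨ +-cong (*-congˡ (linear alt us a v w vs))
                (-‿cong (linear (expand-alternating (∷-alternating alt u)) us a v w vs)) ⟩
    u 0 * (a * gv + gw) + (- (a * Gv + Gw))
      ≈⟨ +-congˡ (-‿+-comm _ _) ⟨
    u 0 * (a * gv + gw) + (- (a * Gv) + (- Gw))
      ≈⟨ +-congˡ (+-congʳ (-‿distribʳ-* a Gv)) ⟩
    u 0 * (a * gv + gw) + (a * (- Gv) + (- Gw))
      ≈⟨ solve 6 (λ u a gv gw Gv Gw → u :* (a :* gv :+ gw) :+ (a :* Gv :+ Gw)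
                   := a :* (u :* gv :+ Gv) :+ (u :* gw :+ Gw)) refl
           (u 0) a gv gw (- Gv) (- Gw) ⟩
    a * (u 0 * gv + (- Gv)) + (u 0 * gw + (- Gw)) ∎
    where
    gv = G (us ++ v ∷ vs)
    gw = G (us ++ w ∷ vs)
    Gv = expand (G ∘ (u ∷_)) (us ++ v ∷ vs)
    Gw = expand (G ∘ (u ∷_)) (us ++ w ∷ vs)
  expand-alternating {G} alt .equal [] v vs = begin
    v 0 * G (v ∷ vs) + (- (v 0 * G (v ∷ vs) + (- expand (λ us → G (v ∷ v ∷ us)) vs)))
      ≈⟨ +-congˡ (-‿cong (+-congˡ (trans (-‿cong (expand-zero vs (equal alt [] v))) -0#≈0#))) ⟩
    v 0 * G (v ∷ vs) + (- (v 0 * G (v ∷ vs) + 0#))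
      ≈⟨ +-congˡ (-‿cong (+-identityʳ _)) ⟩
    v 0 * G (v ∷ vs) + (- (v 0 * G (v ∷ vs)))
      ≈⟨ -‿inverseʳ _ ⟩
    0# ∎
  expand-alternating {G} alt .equal (u ∷ us) v vs = begin
    u 0 * G (us ++ v ∷ v ∷ vs) + (- expand (G ∘ (u ∷_)) (us ++ v ∷ v ∷ vs))
      ≈⟨ +-cong (trans (*-congˡ (equal alt us v vs)) (zeroʳ _))
           (trans (-‿cong (equal (expand-alternating (∷-alternating alt u)) us v vs)) -0#≈0#) ⟩
    0# + 0#  ≈⟨ +-identityˡ 0# ⟩
    0#       ∎

  rowsDet-alternating : ∀ n → IsAlternating (rowsDet n)
  rowsDet-alternating zero .cong []      = refl
  rowsDet-alternating zero .cong (_ ∷ _) = refl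
  rowsDet-alternating zero .linear []      a v w vs = sym (trans (+-identityʳ _) (zeroʳ a))
  rowsDet-alternating zero .linear (_ ∷ _) a v w vs = sym (trans (+-identityʳ _) (zeroʳ a))
  rowsDet-alternating zero .equal []      v vs = refl
  rowsDet-alternating zero .equal (_ ∷ _) v vs = refl
  rowsDet-alternating (suc n) = expand-alternating (map-tail-alternating (rowsDet-alternating n))

  module _ {G : List Row → Carrier} (alt : IsAlternating G) where

    zero-row : ∀ vs → G ((λ _ → 0#) ∷ vs) ≈ 0#
    zero-row vs = x+x≈x⇒x≈0 _ (begin
      G (𝟎 ∷ vs) + G (𝟎 ∷ vs)         ≈⟨ +-congʳ (*-identityˡ _) ⟨
      1# * G (𝟎 ∷ vs) + G (𝟎 ∷ vs)    ≈⟨ linear alt [] 1# 𝟎 𝟎 vs ⟨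
      G ((1# ⊙ 𝟎 ⊕ 𝟎) ∷ vs)           ≈⟨ cong alt ((λ _ → trans (+-identityʳ _) (zeroʳ 1#)) ∷ Pointwise-refl) ⟩
      G (𝟎 ∷ vs)                      ∎)
      where
      𝟎 : Row
      𝟎 _ = 0#

    row-+ : ∀ us v w vs → G (us ++ (v ⊕ w) ∷ vs) ≈ G (us ++ v ∷ vs) + G (us ++ w ∷ vs)
    row-+ us v w vs = begin
      G (us ++ (v ⊕ w) ∷ vs)      ≈⟨ cong alt (Pointwise.++⁺ (Pointwise-refl {us})
                                       ((λ _ → +-congʳ (sym (*-identityˡ _))) ∷ Pointwise-refl)) ⟩
      G (us ++ (1# ⊙ v ⊕ w) ∷ vs) ≈⟨ linear alt us 1# v w vs ⟩
      1# * G (us ++ v ∷ vs) + G (us ++ w ∷ vs) ≈⟨ +-congʳ (*-identityˡ _) ⟩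
      G (us ++ v ∷ vs) + G (us ++ w ∷ vs) ∎

    exchange : ∀ v w vs → G (v ∷ w ∷ vs) ≈ - G (w ∷ v ∷ vs)
    exchange v w vs = +-inverseʳ-unique _ _ (begin
      G (w ∷ v ∷ vs) + G (v ∷ w ∷ vs)
        ≈⟨ +-cong (trans (+-congʳ (equal alt [] w vs)) (+-identityˡ _))
                  (trans (+-congˡ (equal alt [] v vs)) (+-identityʳ _)) ⟨
      (G (w ∷ w ∷ vs) + G (w ∷ v ∷ vs)) + (G (v ∷ w ∷ vs) + G (v ∷ v ∷ vs))
        ≈⟨ +-cong (row-+ (w ∷ []) w v vs) (row-+ (v ∷ []) w v vs) ⟨
      G (w ∷ (w ⊕ v) ∷ vs) + G (v ∷ (w ⊕ v) ∷ vs)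
        ≈⟨ row-+ [] w v ((w ⊕ v) ∷ vs) ⟨
      G ((w ⊕ v) ∷ (w ⊕ v) ∷ vs)
        ≈⟨ equal alt [] (w ⊕ v) vs ⟩
      0# ∎)

  -- Moving the first row past the rows us costs one sign for each of them.
  move : ∀ {G} → IsAlternating G → ∀ v us ws → G (v ∷ us ++ ws) ≈ sign (length us) * G (us ++ v ∷ ws)
  move     alt v []       ws = sym (*-identityˡ _)
  move {G} alt v (u ∷ us) ws = begin
    G (v ∷ u ∷ us ++ ws)                            ≈⟨ exchange alt v u (us ++ ws) ⟩
    - G (u ∷ v ∷ us ++ ws)                          ≈⟨ -‿cong (move (∷-alternating alt u) v us ws) ⟩
    - (sign (length us) * G (u ∷ us ++ v ∷ ws))     ≈⟨ -‿distribˡ-* _ _ ⟩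
    - sign (length us) * G (u ∷ us ++ v ∷ ws)       ≈⟨ *-congʳ (sign-suc (length us)) ⟨
    sign (suc (length us)) * G (u ∷ us ++ v ∷ ws)   ∎

  repeated-row : ∀ {G} → IsAlternating G → ∀ v us ws → G (v ∷ us ++ v ∷ ws) ≈ 0#
  repeated-row alt v us ws = trans (move alt v us (v ∷ ws)) (trans (*-congˡ (equal alt us v ws)) (zeroʳ _))

  -- Linearity in the first row.
  row-∑ : ∀ {G} → IsAlternating G → ∀ {n} (ψ : Fin n → Carrier) (e : Fin n → Row) vs →
    G ((λ j → ∑ λ p → ψ p * e p j) ∷ vs) ≈ ∑ λ p → ψ p * G (e p ∷ vs)
  row-∑ alt {zero}  ψ e vs = zero-row alt vs
  row-∑ alt {suc n} ψ e vs = trans (linear alt [] (ψ Fin.zero) (e Fin.zero) _ vs)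
    (+-congˡ (row-∑ alt (ψ ∘ Fin.suc) (e ∘ Fin.suc) vs))

  rowsDet-zero-row : ∀ n v vs → (∀ j → j < n → v j ≈ 0#) → rowsDet n (v ∷ vs) ≈ 0#
  rowsDet-zero-row zero    v vs v≈0 = refl
  rowsDet-zero-row (suc n) v vs v≈0 = begin
    v 0 * _ + (- expand (λ us → rowsDet n (tail v ∷ map tail us)) vs)
      ≈⟨ +-cong (trans (*-congʳ (v≈0 0 z<s)) (zeroˡ _)) (-‿cong (expand-zero vs λ us →
           rowsDet-zero-row n (tail v) (map tail us) λ j j<n → v≈0 (suc j) (s<s j<n))) ⟩
    0# + (- 0#) ≈⟨ -‿inverseʳ 0# ⟩
    0#          ∎

  -- Expansion along a first row 1, 0, …, 0.
  rowsDet-unit-row : ∀ n v vs → v 0 ≈ 1# → (∀ j → j < n → v (suc j) ≈ 0#) →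
    rowsDet (suc n) (v ∷ vs) ≈ rowsDet n (map tail vs)
  rowsDet-unit-row n v vs v₀≈1 v≈0 = begin
    v 0 * rowsDet n (map tail vs) + (- expand (λ us → rowsDet n (tail v ∷ map tail us)) vs)
      ≈⟨ +-cong (trans (*-congʳ v₀≈1) (*-identityˡ _)) (trans (-‿cong (expand-zero vs λ us →
           rowsDet-zero-row n (tail v) (map tail us) v≈0)) -0#≈0#) ⟩
    rowsDet n (map tail vs) + 0#  ≈⟨ +-identityʳ _ ⟩
    rowsDet n (map tail vs)       ∎

  expand-tabulate : ∀ G {n} (v : Fin (suc n) → Row) →
    expand G (tabulate v) ≈ ∑ λ i → sign (toℕ i) * v i 0 * G (tabulate (v ∘ punchIn i))
  expand-tabulate G {zero}  v = +-cong (*-congʳ (sym (*-identityˡ _))) -0#≈0#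
  expand-tabulate G {suc n} v = +-cong (*-congʳ (sym (*-identityˡ _))) (begin
    - expand (G ∘ (v Fin.zero ∷_)) (tabulate (v ∘ Fin.suc))
      ≈⟨ -‿cong (expand-tabulate (G ∘ (v Fin.zero ∷_)) (v ∘ Fin.suc)) ⟩
    - ∑ (λ i → sign (toℕ i) * v (Fin.suc i) 0 * H i)
      ≈⟨ ∑-neg (λ i → sign (toℕ i) * v (Fin.suc i) 0 * H i) ⟨
    ∑ (λ i → - (sign (toℕ i) * v (Fin.suc i) 0 * H i))
      ≈⟨ sum-cong-≋ (λ i → begin
           - (sign (toℕ i) * v (Fin.suc i) 0 * H i)  ≈⟨ -‿distribˡ-* _ _ ⟩
           - (sign (toℕ i) * v (Fin.suc i) 0) * H i  ≈⟨ *-congʳ (-‿distribˡ-* _ _) ⟩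
           - sign (toℕ i) * v (Fin.suc i) 0 * H i    ≈⟨ *-congʳ (*-congʳ (sign-suc (toℕ i))) ⟨
           sign (suc (toℕ i)) * v (Fin.suc i) 0 * H i ∎) ⟩
    ∑ (λ i → sign (suc (toℕ i)) * v (Fin.suc i) 0 * H i) ∎)
    where
    H : Fin (suc n) → Carrier
    H i = G (tabulate (v ∘ punchIn (Fin.suc i)))

  -- Deleting a row and the first column turns v into tail ∘ v ∘ punchIn i.
  det-rowsDet : ∀ {n} (v : Fin n → Row) → det (λ i j → v i (toℕ j)) ≈ rowsDet n (tabulate v)
  det-rowsDet {zero}  v = refl
  det-rowsDet {suc n} v = begin
    det (λ i j → v i (toℕ j))
      ≈⟨ det-column (λ i j → v i (toℕ j)) ⟩
    ∑ (λ i → sign (toℕ i) * v i 0 * det (λ k l → tail (v (punchIn i k)) (toℕ l)))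
      ≈⟨ sum-cong-≋ (λ i → *-congˡ {sign (toℕ i) * v i 0} (trans (det-rowsDet (tail ∘ v ∘ punchIn i))
           (reflexive (≡.cong (rowsDet n) (≡.sym (List.map-tabulate (v ∘ punchIn i) tail)))))) ⟩
    ∑ (λ i → sign (toℕ i) * v i 0 * rowsDet n (map tail (tabulate (v ∘ punchIn i))))
      ≈⟨ expand-tabulate (rowsDet n ∘ map tail) v ⟨
    rowsDet (suc n) (tabulate v) ∎

-- Words and complementary minors

-- Words in the letters true and false, standing for subsets of the positions
-- 0, …, N-1.  Positions decrease along the word: the first letter of a word of
-- length N+1 is at position N, its last letter at position 0.
Word : ℕ → Set
Word = Vec Bool

-- The positions of the letter true, in decreasing order.
trues : ∀ {N} → Word N → List ℕ
trues []                  = []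
trues {suc N} (true  ∷ w) = N ∷ trues w
trues         (false ∷ w) = trues w

-- The positions of the letter false, in increasing order.
falses : ∀ {N} → Word N → List ℕ
falses []                  = []
falses         (true  ∷ w) = falses w
falses {suc N} (false ∷ w) = falses w ++ [ N ]

length-falses-∷ : ∀ {N} (w : Word N) → length (falses (false ∷ w)) ≡ suc (length (falses w))
length-falses-∷ {N} w = ≡.trans (List.length-++ (falses w)) (ℕ.+-comm _ 1)

length-trues+falses : ∀ {N} (w : Word N) → length (trues w) ℕ.+ length (falses w) ≡ N
length-trues+falses []          = ≡.refl
length-trues+falses (true  ∷ w) = ≡.cong suc (length-trues+falses w)
length-trues+falses (false ∷ w) = ≡.trans (≡.cong (length (trues w) ℕ.+_) (length-falses-∷ w))
  (≡.trans (ℕ.+-suc _ _) (≡.cong suc (length-trues+falses w)))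

falses-all : ∀ {N} (w : Word N) → length (trues w) ≡ 0 → falses w ≡ applyUpTo id N
falses-all         []          _  = ≡.refl
falses-all {suc N} (false ∷ w) eq =
  ≡.trans (≡.cong (_++ [ N ]) (falses-all w eq)) (List.applyUpTo-∷ʳ id N)

module Duality {c ℓ : Level} (R : CommutativeRing c ℓ) where
  open CommutativeRing R hiding (_-_; zero)
  open RawRingOps rawRing using (∑)
  open SumProperties +-commutativeMonoid using (sum-cong-≋)
  open SemiringSolver commutativeSemiring using (solve; _:*_; _:=_)
  open RingProperties ring using (-‿distribˡ-*; -‿distribʳ-*; -0#≈0#)
  open RawRing (rawRing ⟦z⟧) using () renaming (_*_ to _⋆_; 1# to 𝟏; _≈_ to _≈ᶻ_)
  open SetoidReasoning setoid
  open RingFacts R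
  open PowerSeries R using (Series; twist)
  open Determinants R

  -- The coefficient of index m - n, which is 0 for m < n.
  _[_⊖_] : Series → ℕ → ℕ → Carrier
  a [ m     ⊖ zero  ] = a m
  a [ zero  ⊖ suc n ] = 0#
  a [ suc m ⊖ suc n ] = a [ m ⊖ n ]

  ⊖-cancel : ∀ a m n k → a [ m ℕ.+ k ⊖ n ℕ.+ k ] ≡ a [ m ⊖ n ]
  ⊖-cancel a m n zero    = ≡.cong₂ (a [_⊖_]) (ℕ.+-identityʳ m) (ℕ.+-identityʳ n)
  ⊖-cancel a m n (suc k) =
    ≡.trans (≡.cong₂ (a [_⊖_]) (ℕ.+-suc m k) (ℕ.+-suc n k)) (⊖-cancel a m n k)

  ∑-last : ∀ n (f : ℕ → Carrier) → ∑ {suc n} (f ∘ toℕ) ≈ ∑ {n} (f ∘ toℕ) + f n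
  ∑-last zero    f = +-comm _ _
  ∑-last (suc n) f = trans (+-congˡ (∑-last n (f ∘ suc))) (sym (+-assoc _ _ _))

  -- The signed sum of φ(p) Θ(w′) over all words w′ obtained from w by turning
  -- a letter true, at position p, into false; the sign is negative if an odd
  -- number of letters true precede it.
  flips : (ℕ → Carrier) → ∀ {N} → (Word N → Carrier) → Word N → Carrier
  flips φ         Θ []          = 0#
  flips φ {suc N} Θ (true  ∷ w) = φ N * Θ (false ∷ w) + (- flips φ (Θ ∘ (true ∷_)) w)
  flips φ         Θ (false ∷ w) = flips φ (Θ ∘ (false ∷_)) w

  flips-cong : ∀ {φ N} {Θ Θ′ : Word N → Carrier} w →
    (∀ w′ → suc (length (trues w′)) ≡ length (trues w) → Θ w′ ≈ Θ′ w′) →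
    flips φ Θ w ≈ flips φ Θ′ w
  flips-cong []          eq = refl
  flips-cong (true  ∷ w) eq = +-cong (*-congˡ (eq (false ∷ w) ≡.refl))
    (-‿cong (flips-cong w λ w′ → eq (true ∷ w′) ∘ ≡.cong suc))
  flips-cong (false ∷ w) eq = flips-cong w λ w′ → eq (false ∷ w′)

  expand-trues : ∀ G (h : ℕ → Row) {N} (w : Word N) →
    expand G (map h (trues w)) ≈ flips (λ p → h p 0) (λ w → G (map h (trues w))) w
  expand-trues G h         []          = refl
  expand-trues G h {suc N} (true  ∷ w) = +-congˡ (-‿cong (expand-trues (G ∘ (h N ∷_)) h w))
  expand-trues G h         (false ∷ w) = expand-trues G h w

  -- A row e p placed in front of the rows of the letters false either repeats
  -- one of them, or can be moved to the place belonging to p.  If p is the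
  -- position of a letter true, then p letters follow it: the sign (-1)^p
  -- compensates the letters false among them, which the row has to pass, and
  -- leaves the letters true, which up to a common sign is the sign in flips.
  insert-falses : ∀ {G} → IsAlternating G → ∀ φ (e : ℕ → Row) n {N} (w : Word N) →
    ∑ {N} (λ i → sign (toℕ i ℕ.+ n) * φ (toℕ i) * G (e (toℕ i) ∷ map e (falses w)))
      ≈ sign (suc (length (trues w) ℕ.+ n)) * flips φ (λ w → G (map e (falses w))) w
  insert-falses alt φ e n [] = sym (zeroʳ _)
  insert-falses {G} alt φ e n {suc N} (true ∷ w) = begin
    ∑ {suc N} (λ i → sign (toℕ i ℕ.+ n) * φ (toℕ i) * G (e (toℕ i) ∷ es))
      ≈⟨ ∑-last N (λ p → sign (p ℕ.+ n) * φ p * G (e p ∷ es)) ⟩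
    ∑ {N} (λ i → sign (toℕ i ℕ.+ n) * φ (toℕ i) * G (e (toℕ i) ∷ es))
      + sign (N ℕ.+ n) * φ N * G (e N ∷ es)
      ≈⟨ +-cong (insert-falses alt φ e n w) (*-congˡ move-last) ⟩
    sign (suc (t ℕ.+ n)) * X + sign (N ℕ.+ n) * φ N * (sign f * Y)
      ≈⟨ +-cong (trans (*-congʳ (sign-suc (t ℕ.+ n))) (trans (sym (-‿distribˡ-* _ _)) (-‿distribʳ-* _ _)))
           (solve 4 (λ s φ f y → s :* φ :* (f :* y) := s :* f :* (φ :* y)) refl
             (sign (N ℕ.+ n)) (φ N) (sign f) Y) ⟩
    sign (t ℕ.+ n) * (- X) + sign (N ℕ.+ n) * sign f * (φ N * Y)
      ≈⟨ +-congˡ (*-congʳ signs) ⟩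
    sign (t ℕ.+ n) * (- X) + sign (t ℕ.+ n) * (φ N * Y)
      ≈⟨ trans (+-comm _ _) (sym (distribˡ _ _ _)) ⟩
    sign (t ℕ.+ n) * (φ N * Y + (- X))
      ≈⟨ *-congʳ (sign-suc-suc (t ℕ.+ n)) ⟨
    sign (suc (suc (t ℕ.+ n))) * (φ N * Y + (- X)) ∎
    where
    es = map e (falses w)
    t  = length (trues w)
    f  = length (falses w)
    X  = flips φ (λ w → G (map e (falses w))) w
    Y  = G (map e (falses w ++ [ N ]))
    move-last : G (e N ∷ es) ≈ sign f * Y
    move-last = begin
      G (e N ∷ es)                         ≡⟨ ≡.cong (G ∘ (e N ∷_)) (List.++-identityʳ es) ⟨
      G (e N ∷ es ++ [])                   ≈⟨ move alt (e N) es [] ⟩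
      sign (length es) * G (es ++ [ e N ]) ≡⟨ ≡.cong₂ (λ l us → sign l * G us)
                                                (List.length-map e (falses w)) (≡.sym (List.map-++ e (falses w) [ N ])) ⟩
      sign f * Y                           ∎
    rearrange : ∀ t f n → t ℕ.+ f ℕ.+ n ≡ t ℕ.+ n ℕ.+ f
    rearrange = solve-∀
    signs : sign (N ℕ.+ n) * sign f ≈ sign (t ℕ.+ n)
    signs = begin
      sign (N ℕ.+ n) * sign f              ≡⟨ ≡.cong (λ N → sign (N ℕ.+ n) * sign f) (length-trues+falses w) ⟨
      sign (t ℕ.+ f ℕ.+ n) * sign f        ≡⟨ ≡.cong (λ k → sign k * sign f) (rearrange t f n) ⟩
      sign (t ℕ.+ n ℕ.+ f) * sign f        ≈⟨ *-congʳ (sign-+ (t ℕ.+ n) f) ⟩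
      sign (t ℕ.+ n) * sign f * sign f     ≈⟨ *-assoc _ _ _ ⟩
      sign (t ℕ.+ n) * (sign f * sign f)   ≈⟨ *-congˡ (sign² f) ⟩
      sign (t ℕ.+ n) * 1#                  ≈⟨ *-identityʳ _ ⟩
      sign (t ℕ.+ n)                       ∎
  insert-falses {G} alt φ e n {suc N} (false ∷ w) = begin
    ∑ {suc N} (λ i → sign (toℕ i ℕ.+ n) * φ (toℕ i) * G (e (toℕ i) ∷ map e (falses w ++ [ N ])))
      ≈⟨ ∑-last N (λ p → sign (p ℕ.+ n) * φ p * G (e p ∷ map e (falses w ++ [ N ]))) ⟩
    ∑ {N} (λ i → sign (toℕ i ℕ.+ n) * φ (toℕ i) * G (e (toℕ i) ∷ map e (falses w ++ [ N ])))
      + sign (N ℕ.+ n) * φ N * G (e N ∷ map e (falses w ++ [ N ]))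
      ≡⟨ ≡.cong (λ es → ∑ {N} (λ i → sign (toℕ i ℕ.+ n) * φ (toℕ i) * G (e (toℕ i) ∷ es))
           + sign (N ℕ.+ n) * φ N * G (e N ∷ es)) (List.map-++ e (falses w) [ N ]) ⟩
    ∑ {N} (λ i → sign (toℕ i ℕ.+ n) * φ (toℕ i) * G (e (toℕ i) ∷ map e (falses w) ++ [ e N ]))
      + sign (N ℕ.+ n) * φ N * G (e N ∷ map e (falses w) ++ [ e N ])
      ≈⟨ +-cong (insert-falses (++-alternating alt [ e N ]) φ e n w)
           (trans (*-congˡ (repeated-row alt (e N) (map e (falses w)) [])) (zeroʳ _)) ⟩
    sign (suc (length (trues w) ℕ.+ n)) * flips φ (λ w → G (map e (falses w) ++ [ e N ])) w + 0#
      ≈⟨ +-identityʳ _ ⟩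
    sign (suc (length (trues w) ℕ.+ n)) * flips φ (λ w → G (map e (falses w) ++ [ e N ])) w
      ≈⟨ *-congˡ (flips-cong w λ w′ _ → reflexive (≡.cong G (List.map-++ e (falses w′) [ N ]))) ⟨
    sign (suc (length (trues w) ℕ.+ n)) * flips φ (λ w → G (map e (falses w ++ [ N ]))) w ∎

  rowsDet-cong : ∀ n {us vs} → Pointwise _≋_ us vs → rowsDet n us ≈ rowsDet n vs
  rowsDet-cong n = IsAlternating.cong (rowsDet-alternating n)

  map-pointwise : ∀ {f g : ℕ → Row} → (∀ p → f p ≋ g p) → ∀ ps → Pointwise _≋_ (map f ps) (map g ps)
  map-pointwise eq []       = []
  map-pointwise eq (p ∷ ps) = eq p ∷ map-pointwise eq ps

  expand-zero-heads : ∀ G (f : ℕ → Row) → (∀ p → f p 0 ≈ 0#) → ∀ N → expand G (applyUpTo f N) ≈ 0#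
  expand-zero-heads G f f≈0 zero    = refl
  expand-zero-heads G f f≈0 (suc N) = begin
    f 0 0 * G _ + (- expand _ (applyUpTo (f ∘ suc) N))
      ≈⟨ +-cong (trans (*-congʳ (f≈0 0)) (zeroˡ _))
           (trans (-‿cong (expand-zero-heads (G ∘ (f 0 ∷_)) (f ∘ suc) (f≈0 ∘ suc) N)) -0#≈0#) ⟩
    0# + 0#  ≈⟨ +-identityˡ 0# ⟩
    0#       ∎

  module _ (r c : Series) (c₀≈1 : c 0 ≈ 1#) (r⋆c≈1 : twist r ⋆ c ≈ᶻ 𝟏) where

    -- For a word with n letters true, the rows h n p belong to the letters
    -- true in the determinant of r, and the rows e n p to the letters false in
    -- the determinant of c.  Deleting the first column lowers n for h, and
    -- raises n for e.
    private
      h e : ℕ → ℕ → Row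
      h n p j = r [ suc (j ℕ.+ p) ⊖ n ]
      e n p j = c [ j ℕ.+ n ⊖ p ]

    ⋆-truncated : ∀ K (a : Series) j → j < K → ∑ {K} (λ i → a (toℕ i) * c [ j ⊖ toℕ i ]) ≈ (a ⋆ c) j
    ⋆-truncated (suc K) a zero    _         = +-congˡ (∑-zero {K} λ _ → zeroʳ _)
    ⋆-truncated (suc K) a (suc j) (s≤s j<K) = +-congˡ (⋆-truncated K (a ∘ suc) j j<K)

    -- The terms with i < n vanish; the others are reindexed by i - n.
    strip : ∀ n K j →
      ∑ {n ℕ.+ K} (λ i → sign (toℕ i ℕ.+ n) * r [ toℕ i ⊖ n ] * c [ j ℕ.+ n ⊖ toℕ i ])
        ≈ ∑ {K} (λ i → twist r (toℕ i) * c [ j ⊖ toℕ i ])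
    strip zero    K j = sum-cong-≋ {K} λ i → reflexive (≡.cong₂
      (λ p q → sign p * r (toℕ i) * c [ q ⊖ toℕ i ]) (ℕ.+-identityʳ (toℕ i)) (ℕ.+-identityʳ j))
    strip (suc n) K j = begin
      sign (suc n) * 0# * c (j ℕ.+ suc n) + ∑ {n ℕ.+ K} (λ i →
        sign (suc (toℕ i) ℕ.+ suc n) * r [ toℕ i ⊖ n ] * c [ j ℕ.+ suc n ⊖ suc (toℕ i) ])
        ≈⟨ +-cong (trans (*-congʳ (zeroʳ _)) (zeroˡ _)) (sum-cong-≋ {n ℕ.+ K} λ i → *-cong
             (*-congʳ (trans (reflexive (≡.cong (sign ∘ suc) (ℕ.+-suc (toℕ i) n))) (sign-suc-suc (toℕ i ℕ.+ n))))
             (reflexive (≡.cong (c [_⊖ suc (toℕ i) ]) (ℕ.+-suc j n)))) ⟩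
      0# + ∑ {n ℕ.+ K} (λ i → sign (toℕ i ℕ.+ n) * r [ toℕ i ⊖ n ] * c [ j ℕ.+ n ⊖ toℕ i ])
        ≈⟨ +-identityˡ _ ⟩
      ∑ {n ℕ.+ K} (λ i → sign (toℕ i ℕ.+ n) * r [ toℕ i ⊖ n ] * c [ j ℕ.+ n ⊖ toℕ i ])
        ≈⟨ strip n K j ⟩
      ∑ {K} (λ i → twist r (toℕ i) * c [ j ⊖ toℕ i ]) ∎

    -- The linear combination of the rows e n p that the relation between r
    -- and c makes equal to 1, 0, 0, … in the columns that matter.
    unitRow : ℕ → ℕ → Row
    unitRow n N j = ∑ {N} λ i → sign (toℕ i ℕ.+ n) * r [ toℕ i ⊖ n ] * e n (toℕ i) j

    unitRow≈𝟏 : ∀ {n N} m → suc n ℕ.+ m ≡ N → ∀ j → j ≤ m → unitRow n N j ≈ 𝟏 j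
    unitRow≈𝟏 {n} m ≡.refl j j≤m = begin
      unitRow n (suc n ℕ.+ m) j    ≡⟨ ≡.cong (λ N → unitRow n N j) (ℕ.+-suc n m) ⟨
      unitRow n (n ℕ.+ suc m) j    ≈⟨ strip n (suc m) j ⟩
      ∑ {suc m} (λ i → twist r (toℕ i) * c [ j ⊖ toℕ i ]) ≈⟨ ⋆-truncated (suc m) (twist r) j (s≤s j≤m) ⟩
      (twist r ⋆ c) j              ≈⟨ r⋆c≈1 j ⟩
      𝟏 j                          ∎

    rowsDet-unitriangular : ∀ N → rowsDet N (applyUpTo (e 0) N) ≈ 1#
    rowsDet-unitriangular zero    = refl
    rowsDet-unitriangular (suc N) = begin
      c 0 * rowsDet N (map tail es) + (- expand (λ us → rowsDet N (tail (e 0 0) ∷ map tail us)) es)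
        ≈⟨ +-cong (trans (*-congʳ c₀≈1) (*-identityˡ _))
             (trans (-‿cong (expand-zero-heads _ (e 0 ∘ suc) (λ _ → refl) N)) -0#≈0#) ⟩
      rowsDet N (map tail es) + 0#      ≈⟨ +-identityʳ _ ⟩
      rowsDet N (map tail es)           ≡⟨ ≡.cong (rowsDet N) (List.map-applyUpTo (e 0 ∘ suc) tail N) ⟩
      rowsDet N (applyUpTo (e 0) N)     ≈⟨ rowsDet-unitriangular N ⟩
      1#                                ∎
      where
      es = applyUpTo (e 0 ∘ suc) N

    -- Jacobi's theorem on complementary minors, for the mutually inverse
    -- triangular Toeplitz matrices (r_{j-i}) and ((-1)^{j-i} c_{j-i}).  All
    -- signs cancel because the letters true are read in decreasing order and
    -- the letters false in increasing order.
    complementary-minors : ∀ n {N} (w : Word N) → length (trues w) ≡ n →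
      rowsDet n (map (h n) (trues w)) ≈ rowsDet (length (falses w)) (map (e n) (falses w))
    complementary-minors zero {N} w eq = begin
      rowsDet 0 (map (h 0) (trues w))  ≡⟨ ≡.cong (rowsDet 0 ∘ map (h 0)) (length≡0 (trues w) eq) ⟩
      1#                               ≈⟨ rowsDet-unitriangular N ⟨
      rowsDet N (applyUpTo (e 0) N)    ≡⟨ ≡.cong (rowsDet N) (List.map-applyUpTo id (e 0) N) ⟨
      rowsDet N (map (e 0) (applyUpTo id N))
        ≡⟨ ≡.cong₂ (λ k ps → rowsDet k (map (e 0) ps)) length-falses (falses-all w eq) ⟨
      rowsDet (length (falses w)) (map (e 0) (falses w)) ∎
      where
      length≡0 : ∀ (ps : List ℕ) → length ps ≡ 0 → ps ≡ []
      length≡0 [] _ = ≡.refl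
      length-falses : length (falses w) ≡ N
      length-falses = ≡.trans (≡.cong length (falses-all w eq)) (List.length-applyUpTo id N)
    complementary-minors (suc n) {N} w eq = begin
      expand (rowsDet n ∘ map tail) (map (h (suc n)) (trues w))
        ≈⟨ expand-trues (rowsDet n ∘ map tail) (h (suc n)) w ⟩
      flips φ (λ w′ → rowsDet n (map tail (map (h (suc n)) (trues w′)))) w
        ≈⟨ flips-cong w (λ w′ eq′ → begin
             rowsDet n (map tail (map (h (suc n)) (trues w′)))
               ≡⟨ ≡.cong (rowsDet n) (List.map-∘ (trues w′)) ⟨
             rowsDet n (map (h n) (trues w′))
               ≈⟨ complementary-minors n w′ (ℕ.suc-injective (≡.trans eq′ eq)) ⟩
             rowsDet (length (falses w′)) (map (e n) (falses w′))
               ≡⟨ ≡.cong (λ k → rowsDet k (map (e n) (falses w′))) (one-more w′ eq′) ⟩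
             rowsDet (suc m) (map (e n) (falses w′)) ∎) ⟩
      flips φ (λ w′ → rowsDet (suc m) (map (e n) (falses w′))) w
        -- The sum over flips on the side of c comes from expanding in the
        -- first row a determinant with top row 1, 0, 0, …
        ≈⟨ trans (*-congʳ sign≈1) (*-identityˡ _) ⟨
      sign (suc (length (trues w) ℕ.+ n)) * flips φ (λ w′ → rowsDet (suc m) (map (e n) (falses w′))) w
        ≈⟨ insert-falses (rowsDet-alternating (suc m)) φ (e n) n w ⟨
      ∑ {N} (λ i → sign (toℕ i ℕ.+ n) * φ (toℕ i) * rowsDet (suc m) (e n (toℕ i) ∷ map (e n) (falses w)))
        ≈⟨ row-∑ (rowsDet-alternating (suc m)) {N} (λ i → sign (toℕ i ℕ.+ n) * φ (toℕ i))
             (λ i → e n (toℕ i)) (map (e n) (falses w)) ⟨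
      rowsDet (suc m) (unitRow n N ∷ map (e n) (falses w))
        ≈⟨ rowsDet-unit-row m (unitRow n N) _ (unitRow≈𝟏 m N≡ 0 ℕ.z≤n)
             (λ j j<m → unitRow≈𝟏 m N≡ (suc j) j<m) ⟩
      rowsDet m (map tail (map (e n) (falses w)))
        ≡⟨ ≡.cong (rowsDet m) (List.map-∘ (falses w)) ⟨
      rowsDet m (map (tail ∘ e n) (falses w))
        ≈⟨ rowsDet-cong m (map-pointwise
             (λ p j → reflexive (≡.cong (c [_⊖ p ]) (≡.sym (ℕ.+-suc j n)))) (falses w)) ⟩
      rowsDet m (map (e (suc n)) (falses w)) ∎
      where
      m = length (falses w)
      φ : ℕ → Carrier
      φ p = r [ p ⊖ n ]
      N≡ : suc n ℕ.+ m ≡ N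
      N≡ = ≡.trans (≡.cong (ℕ._+ m) (≡.sym eq)) (length-trues+falses w)
      one-more : ∀ (w′ : Word N) → suc (length (trues w′)) ≡ length (trues w) → length (falses w′) ≡ suc m
      one-more w′ eq′ = ℕ.+-cancelˡ-≡ (length (trues w′)) _ _ (≡.trans (length-trues+falses w′)
        (≡.trans (≡.sym (length-trues+falses w)) (≡.trans (≡.cong (ℕ._+ m) (≡.sym eq′)) (≡.sym (ℕ.+-suc _ m)))))
      sign≈1 : sign (suc (length (trues w) ℕ.+ n)) ≈ 1#
      sign≈1 = trans (reflexive (≡.cong (λ t → sign (suc (t ℕ.+ n))) eq))
        (trans (sign-suc-suc (n ℕ.+ n)) (sign-double n))

-- Conjugate partitions and boundary words

conjPart-accept : ∀ {p j} ps → j < p → conjPart (p ∷ ps) j ≡ suc (conjPart ps j)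
conjPart-accept {j = j} ps j<p = ≡.cong length (List.filter-accept (suc j ℕ.≤?_) j<p)

conjPart-reject : ∀ {p j} ps → p ≤ j → conjPart (p ∷ ps) j ≡ conjPart ps j
conjPart-reject {j = j} ps p≤j = ≡.cong length (List.filter-reject (suc j ℕ.≤?_) (ℕ.≤⇒≯ p≤j))

conjPart-cong-∷ : ∀ p {ps qs} j →
  conjPart ps j ≡ conjPart qs j → conjPart (p ∷ ps) j ≡ conjPart (p ∷ qs) j
conjPart-cong-∷ p {ps} {qs} j eq with suc j ℕ.≤? p
... | yes j<p = ≡.trans (conjPart-accept ps j<p) (≡.trans (≡.cong suc eq) (≡.sym (conjPart-accept qs j<p)))
... | no  j≮p = ≡.trans (conjPart-reject ps p≤j) (≡.trans eq (≡.sym (conjPart-reject qs p≤j)))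
  where p≤j = ℕ.≮⇒≥ j≮p

-- Weakly decreasing sequences; the first n terms of one form a partition with
-- at most n nonzero parts.
Decreasing : (ℕ → ℕ) → Set
Decreasing lam = ∀ i → lam (suc i) ≤ lam i

decreasing-≤-head : ∀ {lam} → Decreasing lam → ∀ i → lam i ≤ lam 0
decreasing-≤-head dec zero    = ℕ.≤-refl
decreasing-≤-head dec (suc i) = ℕ.≤-trans (dec i) (decreasing-≤-head dec i)

conjPart-zero : ∀ {lam} → Decreasing lam → ∀ n {j} → lam 0 ≤ j → conjPart (applyUpTo lam n) j ≡ 0
conjPart-zero {lam} dec n {j} λ₀≤j = ≡.cong length (List.filter-none (suc j ℕ.≤?_)
  (All.applyUpTo⁺₂ lam n λ i → ℕ.≤⇒≯ (ℕ.≤-trans (decreasing-≤-head dec i) λ₀≤j)))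

conjPart-≤ : ∀ lam n j → conjPart (applyUpTo lam n) j ≤ n
conjPart-≤ lam n j = ≡.subst (conjPart (applyUpTo lam n) j ≤_) (List.length-applyUpTo lam n)
  (List.length-filter (suc j ℕ.≤?_) (applyUpTo lam n))

applyUpTo-pointwise : ∀ {a b ℓ} {A : Set a} {B : Set b} {_∼_ : A → B → Set ℓ} {f : ℕ → A} {g : ℕ → B} n →
  (∀ i → i < n → f i ∼ g i) → Pointwise _∼_ (applyUpTo f n) (applyUpTo g n)
applyUpTo-pointwise zero    f∼g = []
applyUpTo-pointwise (suc n) f∼g = f∼g 0 z<s ∷ applyUpTo-pointwise n λ i → f∼g (suc i) ∘ s<s

applyUpTo-cong : ∀ {a} {A : Set a} {f g : ℕ → A} n → (∀ i → i < n → f i ≡ g i) → applyUpTo f n ≡ applyUpTo g n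
applyUpTo-cong n eq = Pointwise.Pointwise-≡⇒≡ (applyUpTo-pointwise n eq)

tabulate-applyUpTo : ∀ {a} {A : Set a} (f : ℕ → A) n → tabulate {n = n} (f ∘ toℕ) ≡ applyUpTo f n
tabulate-applyUpTo f zero    = ≡.refl
tabulate-applyUpTo f (suc n) = ≡.cong (f 0 ∷_) (tabulate-applyUpTo (f ∘ suc) n)

-- The word of the lattice path bounding the diagram of the partition lam in a
-- box with n rows and m columns: its letters true are the vertical steps, one
-- for each part of lam, and its letters false the horizontal steps, one for
-- each part of the conjugate.
record BoundaryWord (lam : ℕ → ℕ) (n m : ℕ) : Set where
  field
    {size}  : ℕ
    word    : Word size
    size≡   : size ≡ n ℕ.+ m
    trues≡  : trues word ≡ applyUpTo (λ i → lam i ℕ.+ (n ∸ suc i)) n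
    falses≡ : falses word ≡ applyUpTo (λ j → (n ∸ conjPart (applyUpTo lam n) j) ℕ.+ j) m

module _ {lam : ℕ → ℕ} {n : ℕ} where
  open BoundaryWord

  horizontal : ∀ {m} → conjPart (applyUpTo lam n) m ≡ 0 → BoundaryWord lam n m → BoundaryWord lam n (suc m)
  horizontal {m} eq b .size     = suc (b .size)
  horizontal {m} eq b .word     = false ∷ b .word
  horizontal {m} eq b .size≡    = ≡.trans (≡.cong suc (b .size≡)) (≡.sym (ℕ.+-suc n m))
  horizontal {m} eq b .trues≡   = b .trues≡
  horizontal {m} eq b .falses≡  = ≡.trans
    (≡.cong₂ (λ ps p → ps ++ [ p ]) (b .falses≡)
      (≡.trans (b .size≡) (≡.cong (λ k → (n ∸ k) ℕ.+ m) (≡.sym eq))))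
    (List.applyUpTo-∷ʳ (λ j → (n ∸ conjPart (applyUpTo lam n) j) ℕ.+ j) m)

  vertical : BoundaryWord (lam ∘ suc) n (lam 0) → BoundaryWord lam (suc n) (lam 0)
  vertical b .size    = suc (b .size)
  vertical b .word    = true ∷ b .word
  vertical b .size≡   = ≡.cong suc (b .size≡)
  vertical b .trues≡  = ≡.cong₂ _∷_ (≡.trans (b .size≡) (ℕ.+-comm n (lam 0))) (b .trues≡)
  vertical b .falses≡ = ≡.trans (b .falses≡) (applyUpTo-cong (lam 0) λ j j<λ₀ →
    ≡.cong (λ k → (suc n ∸ k) ℕ.+ j) (≡.sym (conjPart-accept (applyUpTo (lam ∘ suc) n) j<λ₀)))

boundaryWord : ∀ lam → Decreasing lam → ∀ n {m} → lam 0 ≤ m → BoundaryWord lam n m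
boundaryWord lam dec zero {m} _ = horizontals m
  where
  horizontals : ∀ m → BoundaryWord lam 0 m
  horizontals zero    = record { word = [] ; size≡ = ≡.refl ; trues≡ = ≡.refl ; falses≡ = ≡.refl }
  horizontals (suc m) = horizontal ≡.refl (horizontals m)
boundaryWord lam dec (suc n) {m} λ₀≤m =
  ≡.subst (BoundaryWord lam (suc n)) (ℕ.m∸n+n≡m λ₀≤m) (horizontals (m ∸ lam 0))
  where
  horizontals : ∀ d → BoundaryWord lam (suc n) (d ℕ.+ lam 0)
  horizontals zero    = vertical (boundaryWord (lam ∘ suc) (dec ∘ suc) n (dec 0))
  horizontals (suc d) = horizontal (conjPart-zero dec (suc n) (ℕ.m≤n+m (lam 0) d)) (horizontals d)

nth-decreasing : ∀ {ps} → Linked _≥_ ps → Decreasing (nth ps)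
nth-decreasing []           i       = z≤n
nth-decreasing [-]          i       = z≤n
nth-decreasing (p≥q ∷ _)    zero    = p≥q
nth-decreasing (_ ∷ linked) (suc i) = nth-decreasing linked i

conjPart-pad : ∀ ps n j → length ps ≤ n → conjPart (applyUpTo (nth ps) n) j ≡ conjPart ps j
conjPart-pad []       n       j _           = conjPart-zero (λ _ → z≤n) n z≤n
conjPart-pad (p ∷ ps) (suc n) j (s≤s ps≤n) = conjPart-cong-∷ p j (conjPart-pad ps n j ps≤n)

nth-applyUpTo : ∀ f n j → j < n → nth (applyUpTo f n) j ≡ f j
nth-applyUpTo f (suc n) zero    _         = ≡.refl
nth-applyUpTo f (suc n) (suc j) (s≤s j<n) = nth-applyUpTo (f ∘ suc) n j j<n

nth-applyUpTo-≥ : ∀ f n j → n ≤ j → nth (applyUpTo f n) j ≡ 0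
nth-applyUpTo-≥ f zero    j       _         = ≡.refl
nth-applyUpTo-≥ f (suc n) (suc j) (s≤s n≤j) = nth-applyUpTo-≥ (f ∘ suc) n j n≤j

part-decreasing : ∀ μ → Decreasing (part μ)
part-decreasing μ = nth-decreasing (Partition.decreasing μ)

part-conjugate : ∀ μ n j → ℓen μ ≤ n → part (conjugate μ) j ≡ conjPart (applyUpTo (part μ) n) j
part-conjugate μ n j ℓ≤n with j ℕ.<? part μ 0
... | yes j<μ₀ = ≡.trans (nth-applyUpTo (conjPart (parts μ)) (part μ 0) j j<μ₀)
                   (≡.sym (conjPart-pad (parts μ) n j ℓ≤n))
... | no  j≮μ₀ = ≡.trans (nth-applyUpTo-≥ (conjPart (parts μ)) (part μ 0) j (ℕ.≮⇒≥ j≮μ₀))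
                   (≡.sym (conjPart-zero (part-decreasing μ) n (ℕ.≮⇒≥ j≮μ₀)))

-- Jacobi-Trudi determinants

module JacobiTrudi {c ℓ : Level} (R : CommutativeRing c ℓ) where
  open CommutativeRing R hiding (_-_; zero)
  open RawRingOps rawRing using (det)
  open RawRing (rawRing ⟦z⟧) using () renaming (_*_ to _⋆_; 1# to 𝟏; _≈_ to _≈ᶻ_)
  open SetoidReasoning setoid
  open PowerSeries R using (Series; twist)
  open Determinants R
  open Duality R

  -- det (a_{lamᵢ + j - i}), of size n × n.
  jacobiTrudiDet : Series → (ℕ → ℕ) → ℕ → Carrier
  jacobiTrudiDet a lam n = det {n} λ i j → a [ toℕ j ℕ.+ lam (toℕ i) ⊖ toℕ i ]

  jacobiTrudiDet-rows : ∀ a lam n →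
    jacobiTrudiDet a lam n ≈ rowsDet n (applyUpTo (λ i j → a [ j ℕ.+ lam i ⊖ i ]) n)
  jacobiTrudiDet-rows a lam n = trans (det-rowsDet {n} λ i j → a [ j ℕ.+ lam (toℕ i) ⊖ toℕ i ])
    (reflexive (≡.cong (rowsDet n) (tabulate-applyUpTo (λ i j → a [ j ℕ.+ lam i ⊖ i ]) n)))

  jacobiTrudi-duality : ∀ {r c} → c 0 ≈ 1# → twist r ⋆ c ≈ᶻ 𝟏 →
    ∀ lam → Decreasing lam → ∀ n m → lam 0 ≤ m →
    jacobiTrudiDet r lam n ≈ jacobiTrudiDet c (conjPart (applyUpTo lam n)) m
  jacobiTrudi-duality {r} {c} c₀≈1 r⋆c≈1 lam dec n m λ₀≤m = begin
    jacobiTrudiDet r lam n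
      ≈⟨ jacobiTrudiDet-rows r lam n ⟩
    rowsDet n (applyUpTo (λ i j → r [ j ℕ.+ lam i ⊖ i ]) n)
      ≈⟨ rowsDet-cong n (applyUpTo-pointwise n λ i i<n j → reflexive (≡.sym (row-r i i<n j))) ⟩
    rowsDet n (applyUpTo (λ i j → r [ suc (j ℕ.+ (lam i ℕ.+ (n ∸ suc i))) ⊖ n ]) n)
      ≡⟨ ≡.cong (rowsDet n) (List.map-applyUpTo
           (λ i → lam i ℕ.+ (n ∸ suc i)) (λ p j → r [ suc (j ℕ.+ p) ⊖ n ]) n) ⟨
    rowsDet n (map (λ p j → r [ suc (j ℕ.+ p) ⊖ n ]) (applyUpTo (λ i → lam i ℕ.+ (n ∸ suc i)) n))
      ≡⟨ ≡.cong (λ ps → rowsDet n (map (λ p j → r [ suc (j ℕ.+ p) ⊖ n ]) ps)) trues≡ ⟨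
    rowsDet n (map (λ p j → r [ suc (j ℕ.+ p) ⊖ n ]) (trues word))
      ≈⟨ complementary-minors r c c₀≈1 r⋆c≈1 n word
           (≡.trans (≡.cong length trues≡) (List.length-applyUpTo (λ i → lam i ℕ.+ (n ∸ suc i)) n)) ⟩
    rowsDet (length (falses word)) (map (λ p j → c [ j ℕ.+ n ⊖ p ]) (falses word))
      ≡⟨ ≡.cong (λ ps → rowsDet (length ps) (map (λ p j → c [ j ℕ.+ n ⊖ p ]) ps)) falses≡ ⟩
    rowsDet (length (applyUpTo q m)) (map (λ p j → c [ j ℕ.+ n ⊖ p ]) (applyUpTo q m))
      ≡⟨ ≡.cong₂ rowsDet (List.length-applyUpTo q m) (List.map-applyUpTo q (λ p j → c [ j ℕ.+ n ⊖ p ]) m) ⟩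
    rowsDet m (applyUpTo (λ i j → c [ j ℕ.+ n ⊖ q i ]) m)
      ≈⟨ rowsDet-cong m (applyUpTo-pointwise m λ i _ j → reflexive (row-c i j)) ⟩
    rowsDet m (applyUpTo (λ i j → c [ j ℕ.+ lam′ i ⊖ i ]) m)
      ≈⟨ jacobiTrudiDet-rows c lam′ m ⟨
    jacobiTrudiDet c lam′ m ∎
    where
    open BoundaryWord (boundaryWord lam dec n λ₀≤m)
    lam′ q : ℕ → ℕ
    lam′ = conjPart (applyUpTo lam n)
    q j = (n ∸ lam′ j) ℕ.+ j
    row-r : ∀ i → i < n → ∀ j → r [ suc (j ℕ.+ (lam i ℕ.+ (n ∸ suc i))) ⊖ n ] ≡ r [ j ℕ.+ lam i ⊖ i ]
    row-r i i<n j = ≡.trans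
      (≡.cong₂ (r [_⊖_]) (shuffle j (lam i) (n ∸ suc i))
        (≡.trans (≡.sym (ℕ.m+[n∸m]≡n i<n)) (≡.sym (ℕ.+-suc i (n ∸ suc i)))))
      (⊖-cancel r (j ℕ.+ lam i) i (suc (n ∸ suc i)))
      where
      shuffle : ∀ a b c → suc (a ℕ.+ (b ℕ.+ c)) ≡ a ℕ.+ b ℕ.+ suc c
      shuffle = solve-∀
    row-c : ∀ i j → c [ j ℕ.+ n ⊖ q i ] ≡ c [ j ℕ.+ lam′ i ⊖ i ]
    row-c i j = ≡.trans
      (≡.cong₂ (c [_⊖_])
        (≡.trans (≡.cong (j ℕ.+_) (≡.sym (ℕ.m+[n∸m]≡n (conjPart-≤ lam n i)))) (≡.sym (ℕ.+-assoc j _ _)))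
        (ℕ.+-comm (n ∸ lam′ i) i))
      (⊖-cancel c (j ℕ.+ lam′ i) i (n ∸ lam′ i))

-- The generating functions

module TwistedInverse {c ℓ : Level} (R : CommutativeRing c ℓ) where
  open PowerSeries R
  open CommutativeRing powerSeriesRing hiding (zero)
  open RawRingOps rawRing using (∏)
  open SemiringSolver commutativeSemiring using (solve; _:*_; _:=_)
  open SetoidReasoning setoid

  twist-∏-inverse : ∀ {M} (a b : Fin M → Series) → (∀ i → twist (a i) * b i ≈ 1#) →
    twist (∏ a) * ∏ b ≈ 1#
  twist-∏-inverse {zero}  a b ab≈1 = begin
    twist 1# * 1#  ≈⟨ *-identityʳ (twist 1#) ⟩
    twist 1#       ≈⟨ twist-𝟏 ⟩
    1#             ∎
  twist-∏-inverse {suc M} a b ab≈1 = begin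
    twist (a₀ * A) * (b₀ * B)          ≈⟨ *-congʳ {b₀ * B} (twist-⋆ a₀ A) ⟩
    twist a₀ * twist A * (b₀ * B)
      ≈⟨ solve 4 (λ s t b c → s :* t :* (b :* c) := s :* b :* (t :* c)) (λ {_} → refl {_})
           (twist a₀) (twist A) b₀ B ⟩
    twist a₀ * b₀ * (twist A * B)      ≈⟨ *-cong {twist a₀ * b₀} {1#} {twist A * B} {1#} (ab≈1 Fin.zero)
                                            (twist-∏-inverse (a ∘ Fin.suc) (b ∘ Fin.suc) (ab≈1 ∘ Fin.suc)) ⟩
    1# * 1#                            ≈⟨ *-identityˡ 1# ⟩
    1#                                 ∎
    where
    a₀ = a Fin.zero
    b₀ = b Fin.zero
    A = ∏ (a ∘ Fin.suc)
    B = ∏ (b ∘ Fin.suc)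

private
  module A = CommutativeRing ℚ⟦X⟧-ring
  module AR = RawRingOps ℚ⟦X⟧-rawRing
  module AF = RingFacts ℚ⟦X⟧-ring
  module AP = PowerSeries ℚ⟦X⟧-ring
  module Z = CommutativeRing AP.powerSeriesRing
  module ZR = RawRingOps ℚ⟦X⟧⟦z⟧-rawRing

∑-coeff : ∀ {k} (v : Fin k → ℚ⟦X⟧) α → AR.∑ v α ≡ ℚ∑.∑ λ i → v i α
∑-coeff {zero}  v α = constX-zero α
∑-coeff {suc k} v α = ≡.cong (v Fin.zero α ℚ.+_) (∑-coeff (v ∘ Fin.suc) α)

-- Convergence of a sequence in ℚ[[X]]: every coefficient is eventually constant.
_⟶_ : (ℕ → ℚ⟦X⟧) → ℚ⟦X⟧ → Set
F ⟶ G = ∀ α → ∃ λ N → ∀ M → N ≤ M → F M α ≡ G α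

⟶-constant : ∀ {F G} → (∀ M → F M ≗ G) → F ⟶ G
⟶-constant F≗G α = 0 , λ M _ → F≗G M α

⟶-unique : ∀ {F G H} → F ⟶ G → (∀ M → F M ≗ H) → G ≗ H
⟶-unique F⟶G F≗H α with F⟶G α
... | N , stable = ≡.trans (≡.sym (stable N ℕ.≤-refl)) (F≗H N α)

eventually-∑ : ∀ {k} {v : ℕ → Fin k → ℚ} {w : Fin k → ℚ} →
  (∀ i → ∃ λ N → ∀ M → N ≤ M → v M i ≡ w i) →
  ∃ λ N → ∀ M → N ≤ M → ℚ∑.∑ (v M) ≡ ℚ∑.∑ w
eventually-∑ {zero}  ev = 0 , λ _ _ → ≡.refl
eventually-∑ {suc k} ev with ev Fin.zero | eventually-∑ (ev ∘ Fin.suc)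
... | N , stable | N′ , stable′ = N ℕ.⊔ N′ , λ M N⊔N′≤M → ≡.cong₂ ℚ._+_
  (stable M (ℕ.m⊔n≤o⇒m≤o N N′ N⊔N′≤M)) (stable′ M (ℕ.m⊔n≤o⇒n≤o N N′ N⊔N′≤M))

⟶-* : ∀ {F F∞ G G∞} → F ⟶ F∞ → G ⟶ G∞ → (λ M → F M *X G M) ⟶ (F∞ *X G∞)
⟶-* F⟶ G⟶ [] with F⟶ [] | G⟶ []
... | N , stable | N′ , stable′ = N ℕ.⊔ N′ , λ M N⊔N′≤M → ≡.cong₂ ℚ._*_
  (stable M (ℕ.m⊔n≤o⇒m≤o N N′ N⊔N′≤M)) (stable′ M (ℕ.m⊔n≤o⇒n≤o N N′ N⊔N′≤M))
⟶-* {F} {F∞} {G} {G∞} F⟶ G⟶ (k ∷ α) = eventually-∑ {suc k} λ i →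
  ⟶-* {λ M → slice (F M) (toℕ i)} {slice F∞ (toℕ i)}
      {λ M → slice (G M) (k ∸ toℕ i)} {slice G∞ (k ∸ toℕ i)}
      (F⟶ ∘ (toℕ i ∷_)) (G⟶ ∘ (k ∸ toℕ i ∷_)) α

⟶-⋆ : ∀ {U V : ℕ → ℚ⟦X⟧⟦z⟧} {U∞ V∞ : ℚ⟦X⟧⟦z⟧} →
  (∀ n → (λ M → U M n) ⟶ U∞ n) → (∀ n → (λ M → V M n) ⟶ V∞ n) →
  ∀ n → (λ M → (U M ZR.* V M) n) ⟶ (U∞ ZR.* V∞) n
⟶-⋆ {U} {V} {U∞} {V∞} U⟶ V⟶ n α
  with eventually-∑ {suc n} {λ M i → (U M (toℕ i) *X V M (n ∸ toℕ i)) α}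
         {λ i → (U∞ (toℕ i) *X V∞ (n ∸ toℕ i)) α}
         (λ i → ⟶-* {λ M → U M (toℕ i)} {U∞ (toℕ i)} {λ M → V M (n ∸ toℕ i)} {V∞ (n ∸ toℕ i)}
                  (U⟶ (toℕ i)) (V⟶ (n ∸ toℕ i)) α)
... | N , stable = N , λ M N≤M → ≡.trans
  (∑-coeff {suc n} (λ i → U M (toℕ i) *X V M (n ∸ toℕ i)) α)
  (≡.trans (stable M N≤M) (≡.sym (∑-coeff {suc n} (λ i → U∞ (toℕ i) *X V∞ (n ∸ toℕ i)) α)))

⟶-twist : ∀ {U : ℕ → ℚ⟦X⟧⟦z⟧} {U∞ : ℚ⟦X⟧⟦z⟧} → (∀ n → (λ M → U M n) ⟶ U∞ n) →
  ∀ n → (λ M → AP.twist (U M) n) ⟶ AP.twist U∞ n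
⟶-twist {U} {U∞} U⟶ n = ⟶-* {λ _ → AF.sign n} {AF.sign n} {λ M → U M n} {U∞ n}
  (⟶-constant λ _ _ → ≡.refl) (U⟶ n)

constX-neg : ∀ q → constX (ℚ.- q) ≗ -X constX q
constX-neg q []          = ≡.refl
constX-neg q (zero  ∷ α) = constX-neg q α
constX-neg q (suc _ ∷ α) = ≡.refl

constX-sign : ∀ n q → constX ((ℚ.- 1ℚ) ℚ∑.^ n ℚ.* q) ≗ AF.sign n *X constX q
constX-sign zero q = A.trans
  (λ α → ≡.cong (λ p → constX p α) (ℚ.*-identityˡ q)) (A.sym (A.*-identityˡ (constX q)))
constX-sign (suc n) q = begin
  constX ((ℚ.- 1ℚ) ℚ.* s ℚ.* q)          ≈⟨ (λ α → ≡.cong (λ p → constX p α)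
                                               (≡.trans (ℚ.*-assoc (ℚ.- 1ℚ) s q)
                                                 (≡.trans (≡.sym (ℚ.neg-distribˡ-* 1ℚ (s ℚ.* q)))
                                                   (≡.cong ℚ.-_ (ℚ.*-identityˡ (s ℚ.* q)))))) ⟩
  constX (ℚ.- (s ℚ.* q))                 ≈⟨ constX-neg (s ℚ.* q) ⟩
  -X constX (s ℚ.* q)                    ≈⟨ A.-‿cong (constX-sign n q) ⟩
  -X (AF.sign n *X constX q)             ≈⟨ -‿distribˡ-* (AF.sign n) (constX q) ⟩
  (-X AF.sign n) *X constX q             ≈⟨ A.*-congʳ {constX q} (AF.sign-suc n) ⟨
  AF.sign (suc n) *X constX q            ∎
  where
  open SetoidReasoning A.setoid
  open RingProperties A.ring using (-‿distribˡ-*)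
  s = (ℚ.- 1ℚ) ℚ∑.^ n

module _ (f : ℚ⟦z⟧) (f₀≡0 : f 0 ≡ 0ℚ) where

  private
    u v : ℕ → ℚ⟦X⟧⟦z⟧
    u i = f ·x i
    v i = (f ⟨-z⟩) ·x i

    -- The factors of the products that define r and c.
    a b : ℕ → ℚ⟦X⟧⟦z⟧
    a i = 1/[1- u i ]
    b i = ZR.1# ZR.- v i

  ·x-zero : ∀ {g : ℚ⟦z⟧} → g 0 ≡ 0ℚ → ∀ i → (g ·x i) 0 ≗ A.0#
  ·x-zero {g} g₀≡0 i = A.trans (A.*-congʳ {x i} λ α → ≡.cong (λ q → constX q α) g₀≡0) (A.zeroˡ (x i))

  twist-·x : ∀ i → AP.twist (v i) Z.≈ u i
  twist-·x i n = begin
    AF.sign n *X (constX ((ℚ.- 1ℚ) ℚ∑.^ n ℚ.* f n) *X x i)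
      ≈⟨ A.*-congˡ {AF.sign n} (A.*-congʳ {x i} (constX-sign n (f n))) ⟩
    AF.sign n *X ((AF.sign n *X constX (f n)) *X x i)
      ≈⟨ A.*-congˡ {AF.sign n} (A.*-assoc (AF.sign n) (constX (f n)) (x i)) ⟩
    AF.sign n *X (AF.sign n *X (constX (f n) *X x i))
      ≈⟨ AP.twist-involutive (u i) n ⟩
    constX (f n) *X x i ∎
    where open SetoidReasoning A.setoid

  twist-b : ∀ i → AP.twist (b i) Z.≈ ZR.1# ZR.- u i
  twist-b i n = begin
    AF.sign n *X (ZR.1# n +X (-X v i n))
      ≈⟨ A.distribˡ (AF.sign n) (ZR.1# n) (-X v i n) ⟩
    (AF.sign n *X ZR.1# n) +X (AF.sign n *X (-X v i n))
      ≈⟨ A.+-cong (AP.twist-𝟏 n) (A.trans (A.sym (-‿distribʳ-* (AF.sign n) (v i n))) (A.-‿cong (twist-·x i n))) ⟩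
    ZR.1# n +X (-X u i n) ∎
    where
    open SetoidReasoning A.setoid
    open RingProperties A.ring using (-‿distribʳ-*)

  twist-a*b : ∀ i → AP.twist (a i) ZR.* b i Z.≈ ZR.1#
  twist-a*b i = begin
    AP.twist (a i) ZR.* b i
      ≈⟨ Z.*-congˡ {AP.twist (a i)} (AP.twist-involutive (b i)) ⟨
    AP.twist (a i) ZR.* AP.twist (AP.twist (b i))
      ≈⟨ AP.twist-⋆ (a i) (AP.twist (b i)) ⟨
    AP.twist (a i ZR.* AP.twist (b i))
      ≈⟨ AP.twist-cong (Z.*-congˡ {a i} (twist-b i)) ⟩
    AP.twist (a i ZR.* (ZR.1# ZR.- u i))
      ≈⟨ AP.twist-cong (AP.geometric-inverse (u i) (·x-zero {f} f₀≡0 i)) ⟩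
    AP.twist ZR.1#
      ≈⟨ AP.twist-𝟏 ⟩
    ZR.1# ∎
    where open SetoidReasoning Z.setoid

  ∏b-zero : ∀ {M} (p : Fin M → ℕ) → ZR.∏ (b ∘ p) 0 ≗ A.1#
  ∏b-zero {zero}  p = A.refl
  ∏b-zero {suc M} p = begin
    (b (p Fin.zero) 0 *X B) +X A.0#     ≈⟨ A.+-identityʳ _ ⟩
    b (p Fin.zero) 0 *X B               ≈⟨ A.*-cong {b (p Fin.zero) 0} {A.1#} {B} {A.1#} b₀≈1 (∏b-zero (p ∘ Fin.suc)) ⟩
    A.1# *X A.1#                        ≈⟨ A.*-identityˡ A.1# ⟩
    A.1#                                ∎
    where
    open SetoidReasoning A.setoid
    open RingProperties A.ring using (-0#≈0#)
    B = ZR.∏ (b ∘ p ∘ Fin.suc) 0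
    b₀≈1 : b (p Fin.zero) 0 ≗ A.1#
    b₀≈1 = A.trans (A.+-congˡ {A.1#} (A.trans (A.-‿cong (·x-zero {f ⟨-z⟩}
      (≡.trans (ℚ.*-identityˡ (f 0)) f₀≡0) (p Fin.zero))) -0#≈0#)) (A.+-identityʳ A.1#)

  -- R(-z) C(z) = 1, for the generating functions R of r and C of c.
  twist-r*c : ∀ r c → Generates-r f r → Generates-c f c →
    AP.twist (genFun r) ZR.* genFun c Z.≈ ZR.1#
  twist-r*c r c gen-r gen-c n = ⟶-unique
    {λ M → (AP.twist (ZR.∏ {M} (a ∘ toℕ)) ZR.* ZR.∏ {M} (b ∘ toℕ)) n}
    (⟶-⋆ {λ M → AP.twist (ZR.∏ {M} (a ∘ toℕ))} {λ M → ZR.∏ {M} (b ∘ toℕ)}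
      (⟶-twist {λ M → ZR.∏ {M} (a ∘ toℕ)} gen-r) gen-c n)
    (λ M → TwistedInverse.twist-∏-inverse ℚ⟦X⟧-ring {M} (a ∘ toℕ) (b ∘ toℕ) (λ i → twist-a*b (toℕ i)) n)

  c-zero : ∀ c → Generates-c f c → series (c 0) ≗ A.1#
  c-zero c gen-c = ⟶-unique {λ M → ZR.∏ {M} (b ∘ toℕ) 0} (gen-c 0) (λ M → ∏b-zero {M} toℕ)

-- From symmetric functions to series

private
  module ΛR = RawRingOps Λ-rawRing

series-∑ : ∀ {n} (v : Fin n → Λ) → series (ΛR.∑ v) ≗ AR.∑ (series ∘ v)
series-∑ {zero}  v = A.refl
series-∑ {suc n} v = A.+-congˡ {series (v Fin.zero)} (series-∑ (v ∘ Fin.suc))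

series-sign : ∀ k → series ((-Λ constΛ 1ℚ) ΛR.^ k) ≗ AF.sign k
series-sign zero    = A.refl
series-sign (suc k) = A.*-congˡ { -X constX 1ℚ} (series-sign k)

series-det : ∀ {n} (M : Fin n → Fin n → Λ) → series (ΛR.det M) ≗ AR.det λ i j → series (M i j)
series-det {zero}  M = A.refl
series-det {suc n} M = A.trans
  (series-∑ λ j → ((-Λ constΛ 1ℚ) ΛR.^ toℕ j) ΛR.* M Fin.zero j ΛR.* ΛR.det (minor j))
  (sum-cong-≋ λ j → A.*-cong
    {series (((-Λ constΛ 1ℚ) ΛR.^ toℕ j) ΛR.* M Fin.zero j)} {AF.sign (toℕ j) *X series (M Fin.zero j)}
    {series (ΛR.det (minor j))} {AR.det λ i k → series (minor j i k)}
    (A.*-congʳ {series (M Fin.zero j)} (series-sign (toℕ j))) (series-det (minor j)))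
  where
  open SumProperties A.+-commutativeMonoid using (sum-cong-≋)
  minor : Fin (suc n) → Fin n → Fin n → Λ
  minor j i k = M (Fin.suc i) (punchIn j k)

open Determinants ℚ⟦X⟧-ring using (det-cong)
open Duality ℚ⟦X⟧-ring using (_[_⊖_])
open JacobiTrudi ℚ⟦X⟧-ring using (jacobiTrudiDet; jacobiTrudi-duality)

at-⊖ : ∀ a m n → series (a at (m ℤ.⊖ n)) ≡ genFun a [ m ⊖ n ]
at-⊖ a zero    zero    = ≡.refl
at-⊖ a (suc m) zero    = ≡.refl
at-⊖ a zero    (suc n) = ≡.refl
at-⊖ a (suc m) (suc n) = ≡.trans (≡.cong (series ∘ (a at_)) (ℤ.[1+m]⊖[1+n]≡m⊖n m n)) (at-⊖ a m n)

at-offset : ∀ a p j i → series (a at (+ p ℤ.+ + j ℤ.- + i)) ≡ genFun a [ j ℕ.+ p ⊖ i ]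
at-offset a p j i = ≡.trans
  (≡.cong (series ∘ (a at_)) (≡.trans (ℤ.m-n≡m⊖n (p ℕ.+ j) i) (≡.cong (ℤ._⊖ i) (ℕ.+-comm p j))))
  (at-⊖ a (j ℕ.+ p) i)

series-jacobiTrudi : ∀ a μ (lam : ℕ → ℕ) → (∀ i → part μ i ≡ lam i) → ∀ n →
  series (jacobiTrudi a μ n) ≗ jacobiTrudiDet (genFun a) lam n
series-jacobiTrudi a μ lam eq n = A.trans
  (series-det {n} λ i j → a at (+ part μ (toℕ i) ℤ.+ + toℕ j ℤ.- + toℕ i))
  (det-cong {n} λ i j → A.reflexive (≡.trans (at-offset a (part μ (toℕ i)) (toℕ j) (toℕ i))
    (≡.cong (λ p → genFun a [ toℕ j ℕ.+ p ⊖ toℕ i ]) (eq (toℕ i)))))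

open RawRing Λ-rawRing using (_≈_)

mainTheorem2 : ∀ (f : ℚ⟦z⟧) → IsDelta f →
    ∀ (r c : ℕ → Λ) → Generates-r f r → Generates-c f c →
    ∀ (μ : Partition) (n m : ℕ) → ℓen μ ≤ n → ℓen (conjugate μ) ≤ m →
    jacobiTrudi r μ n ≈ jacobiTrudi c (conjugate μ) m
mainTheorem2 f δ r c gen-r gen-c μ n m ℓ≤n ℓ′≤m = begin
  series (jacobiTrudi r μ n)
    ≈⟨ series-jacobiTrudi r μ (part μ) (λ _ → ≡.refl) n ⟩
  jacobiTrudiDet (genFun r) (part μ) n
    ≈⟨ jacobiTrudi-duality {genFun r} {genFun c} (c-zero f f₀≡0 c gen-c) (twist-r*c f f₀≡0 r c gen-r gen-c)
         (part μ) (part-decreasing μ) n m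
         (≡.subst (_≤ m) (List.length-applyUpTo (conjPart (parts μ)) (part μ 0)) ℓ′≤m) ⟩
  jacobiTrudiDet (genFun c) μ′ m
    ≈⟨ series-jacobiTrudi c (conjugate μ) μ′ (λ j → part-conjugate μ n j ℓ≤n) m ⟨
  series (jacobiTrudi c (conjugate μ) m) ∎
  where
  open SetoidReasoning A.setoid
  open IsDelta δ using (f₀≡0)
  μ′ = conjPart (applyUpTo (part μ) n)
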